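{- On cycles with $n$ vertices, $k$-PVCR can be solved in $O(n)$ time under each of $\mathsf{TJ}$ and $\mathsf{TAR}(u)$, and in $O(n^2)$ time under $\mathsf{TS}$.
   Context: Fix an integer $k \geq 2$. A $k$-path is a path on $k$ vertices. A vertex subset $I \subseteq V(G)$ is a $k$-path vertex cover of $G$ if every $k$-path in $G$ contains at least one vertex of $I$. A sequence $\langle I_0, \dots, I_\ell \rangle$ of $k$-path vertex covers of $G$ is: a $\mathsf{TS}$-sequence if for each $i<\ell$ there are vertices $x_i,y_i$ with $I_i \setminus I_{i+1} = \{x_i\}$, $I_{i+1}\setminus I_i = \{y_i\}$ and $x_iy_i \in E(G)$; a $\mathsf{TJ}$-sequence if the same holds without requiring $x_iy_i \in E(G)$; a $\mathsf{TAR}(u)$-sequence, for a positive integer $u$, if $|I_i| \le u$ for all $i$ and $|I_i \Delta I_{i+1}| = 1$ for each $i<\ell$. The problem $k$-PVCR under rule $\mathsf{R}$: given a graph $G$ and two distinct $k$-path vertex covers $I,J$ of $G$ (and, for $\mathsf{TAR}(u)$, the positive integer $u$), decide whether an $\mathsf{R}$-sequence between $I$ and $J$ exists. -}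

module Defs where

open import Data.Bool.Base using (Bool; true; false; if_then_else_)
open import Data.Fin.Base using (Fin; zero; suc; toℕ; fromℕ; inject₁)
open import Data.Fin.Permutation using (Permutation′; _⟨$⟩ʳ_)
open import Data.Fin.Subset using (Subset; _∈_; ⁅_⁆; _∪_; _─_; ∣_∣)
open import Data.Nat.Base using (ℕ; zero; suc; pred; _+_; _*_; _≤_; _<_; _≡ᵇ_)
open import Data.Product.Base using (Σ; ∃; ∃₂; _×_; proj₁)
open import Data.Sum.Base using (_⊎_)
open import Data.Unit.Base using (⊤)
open import Data.Vec.Base using (lookup)
open import Function.Bundles using (_⇔_)
open import Function.Definitions using (Injective)
open import Level using (0ℓ)
open import Relation.Binary.Core using (Rel)
open import Relation.Binary.Definitions using (Symmetric; Irreflexive)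
open import Relation.Binary.PropositionalEquality.Core using (_≡_; _≢_)
open import Relation.Nullary.Negation.Core using (¬_)

------------------------------------------------------------------------
-- Graphs, cycles and k-path vertex covers

record Graph (n : ℕ) : Set₁ where
  field
    Adj    : Rel (Fin n) 0ℓ
    sym    : Symmetric Adj
    irrefl : Irreflexive _≡_ Adj

CyclicNext : ∀ {n} → Rel (Fin n) 0ℓ
CyclicNext {n} i j = toℕ j ≡ suc (toℕ i) ⊎ (suc (toℕ i) ≡ n × toℕ j ≡ 0)

-- The vertices may occur around the cycle in any order.
IsCycle : ∀ {n} → Graph n → Set
IsCycle {n} G = 3 ≤ n × Σ (Permutation′ n) λ π → ∀ i j →
  Adj (π ⟨$⟩ʳ i) (π ⟨$⟩ʳ j) ⇔ (CyclicNext i j ⊎ CyclicNext j i)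
  where open Graph G

-- A path is a subgraph, not necessarily an induced one: on a cycle with
-- exactly k vertices there are k-paths.
record Path (k : ℕ) {n} (G : Graph n) : Set where
  open Graph G
  field
    vertex    : Fin k → Fin n
    injective : Injective _≡_ _≡_ vertex
    adjacent  : ∀ {i j} → toℕ j ≡ suc (toℕ i) → Adj (vertex i) (vertex j)

IsPathVertexCover : ℕ → ∀ {n} → Graph n → Subset n → Set
IsPathVertexCover k G I = (p : Path k G) → ∃ λ i → Path.vertex p i ∈ I

------------------------------------------------------------------------
-- Reconfiguration

data Rule : Set where
  TS TJ TAR : Rule

-- The part of an instance beyond the graph and the two covers: the
-- positive bound u for TAR(u), nothing for the other rules.
Parameter : Rule → Set
Parameter TS  = ⊤
Parameter TJ  = ⊤
Parameter TAR = ∃ λ u → 1 ≤ u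

Bounded : (R : Rule) → Parameter R → ∀ {n} → Subset n → Set
Bounded TS  _ I = ⊤
Bounded TJ  _ I = ⊤
Bounded TAR u I = ∣ I ∣ ≤ proj₁ u

Step : Rule → ∀ {n} → Graph n → Subset n → Subset n → Set
Step TS  G I J = ∃₂ λ x y → I ─ J ≡ ⁅ x ⁆ × J ─ I ≡ ⁅ y ⁆ × Graph.Adj G x y
Step TJ  G I J = ∃₂ λ x y → I ─ J ≡ ⁅ x ⁆ × J ─ I ≡ ⁅ y ⁆
Step TAR G I J = ∣ (I ─ J) ∪ (J ─ I) ∣ ≡ 1

record ReconfigurationSequence (k : ℕ) (R : Rule) (u : Parameter R)
         {n} (G : Graph n) (I J : Subset n) : Set where
  field
    ℓ       : ℕ
    term    : Fin (suc ℓ) → Subset n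
    start   : term zero ≡ I
    end     : term (fromℕ ℓ) ≡ J
    cover   : ∀ i → IsPathVertexCover k G (term i)
    bounded : ∀ i → Bounded R u (term i)
    step    : ∀ (i : Fin ℓ) → Step R G (term (inject₁ i)) (term (suc i))

------------------------------------------------------------------------
-- Random access machines
--
-- Programs act on ℕ-valued registers and on ℕ-indexed arrays; a program
-- mentions only finitely many of either.  Every operation and every test
-- takes unit time.  The only arithmetic is increment and decrement, so the
-- largest stored value (including program literals) grows by at most one
-- per step; unit cost is therefore not exploitable through huge numbers,
-- and running times carry over, up to a constant factor, to the RAM with
-- addition and to the word RAM.

record State : Set where
  constructor state
  field
    reg : ℕ → ℕ
    arr : ℕ → ℕ → ℕ
open State public

infixl 9 _[_↦_]
_[_↦_] : ∀ {A : Set} → (ℕ → A) → ℕ → A → ℕ → A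
(f [ i ↦ a ]) j = if i ≡ᵇ j then a else f j

setReg : State → ℕ → ℕ → State
setReg σ r v = state (reg σ [ r ↦ v ]) (arr σ)

setArr : State → ℕ → ℕ → ℕ → State
setArr σ a i v = state (reg σ) (arr σ [ a ↦ arr σ a [ i ↦ v ] ])

infixr 5 _⨾_
data Program : Set where
  skip     : Program
  const    : (r v : ℕ) → Program                 -- r := v
  copy     : (r s : ℕ) → Program                 -- r := s
  inc dec  : (r : ℕ) → Program
  load     : (r a s : ℕ) → Program               -- r := a[s]
  store    : (a s r : ℕ) → Program               -- a[s] := r
  _⨾_      : (P Q : Program) → Program
  ifLess   : (r s : ℕ) (P Q : Program) → Program -- if r < s then P else Q
  whileLess : (r s : ℕ) (P : Program) → Program  -- while r < s do P

-- ⟨ P , σ ⟩⇓[ t ] τ : started in σ, P halts in τ after t time units.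
data ⟨_,_⟩⇓[_]_ : Program → State → ℕ → State → Set where
  skip : ∀ {σ} → ⟨ skip , σ ⟩⇓[ 1 ] σ
  const : ∀ {σ r v} → ⟨ const r v , σ ⟩⇓[ 1 ] setReg σ r v
  copy : ∀ {σ r s} → ⟨ copy r s , σ ⟩⇓[ 1 ] setReg σ r (reg σ s)
  inc : ∀ {σ r} → ⟨ inc r , σ ⟩⇓[ 1 ] setReg σ r (suc (reg σ r))
  dec : ∀ {σ r} → ⟨ dec r , σ ⟩⇓[ 1 ] setReg σ r (pred (reg σ r))
  load : ∀ {σ r a s} →
    ⟨ load r a s , σ ⟩⇓[ 1 ] setReg σ r (arr σ a (reg σ s))
  store : ∀ {σ a s r} →
    ⟨ store a s r , σ ⟩⇓[ 1 ] setArr σ a (reg σ s) (reg σ r)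
  _⨾_ : ∀ {P Q σ τ υ t t′} →
    ⟨ P , σ ⟩⇓[ t ] τ → ⟨ Q , τ ⟩⇓[ t′ ] υ → ⟨ P ⨾ Q , σ ⟩⇓[ t + t′ ] υ
  if-true : ∀ {r s P Q σ τ t} → reg σ r < reg σ s →
    ⟨ P , σ ⟩⇓[ t ] τ → ⟨ ifLess r s P Q , σ ⟩⇓[ suc t ] τ
  if-false : ∀ {r s P Q σ τ t} → reg σ s ≤ reg σ r →
    ⟨ Q , σ ⟩⇓[ t ] τ → ⟨ ifLess r s P Q , σ ⟩⇓[ suc t ] τ
  while-true : ∀ {r s P σ τ υ t t′} → reg σ r < reg σ s →
    ⟨ P , σ ⟩⇓[ t ] τ → ⟨ whileLess r s P , τ ⟩⇓[ t′ ] υ →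
    ⟨ whileLess r s P , σ ⟩⇓[ suc (t + t′) ] υ
  while-false : ∀ {r s P σ} → reg σ s ≤ reg σ r →
    ⟨ whileLess r s P , σ ⟩⇓[ 1 ] σ

------------------------------------------------------------------------
-- Input format

-- Adjacency lists, stored one after the other: the neighbours of v are
-- target e for offset v ≤ e < offset (v + 1), each listed once, in any
-- order.
record AdjacencyLists {n} (G : Graph n) (offset target : ℕ → ℕ) : Set where
  open Graph G
  InList : Fin n → ℕ → Set
  InList v e = offset (toℕ v) ≤ e × e < offset (suc (toℕ v))
  field
    first    : offset 0 ≡ 0
    monotone : ∀ (v : Fin n) → offset (toℕ v) ≤ offset (suc (toℕ v))
    sound    : ∀ v e → InList v e → ∃ λ w → target e ≡ toℕ w × Adj v w
    complete : ∀ v w → Adj v w → ∃ λ e → InList v e × target e ≡ toℕ w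
    unique   : ∀ v e e′ → InList v e → InList v e′ →
               target e ≡ target e′ → e ≡ e′

bit : Bool → ℕ
bit true  = 1
bit false = 0

Represents : (ℕ → ℕ) → ∀ {n} → Subset n → Set
Represents f {n} I = ∀ (v : Fin n) → f (toℕ v) ≡ bit (lookup I v)

ParameterLoaded : (R : Rule) → Parameter R → State → Set
ParameterLoaded TS  _ σ = ⊤
ParameterLoaded TJ  _ σ = ⊤
ParameterLoaded TAR u σ = reg σ 1 ≡ proj₁ u

-- Memory not holding input is unconstrained: programs must initialise it.
record Loaded (R : Rule) (u : Parameter R) {n} (G : Graph n)
         (I J : Subset n) (σ : State) : Set where
  field
    order     : reg σ 0 ≡ n
    parameter : ParameterLoaded R u σ
    graph     : AdjacencyLists G (arr σ 0) (arr σ 1)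
    source    : Represents (arr σ 2) I
    goal      : Represents (arr σ 3) J

------------------------------------------------------------------------
-- Solving k-PVCR on cycles

Answer : Set → State → Set
Answer A σ = (reg σ 0 ≡ 1 × A) ⊎ (reg σ 0 ≡ 0 × ¬ A)

SolvesOnCycles : (k : ℕ) → Rule → Program → (ℕ → ℕ) → Set₁
SolvesOnCycles k R P T =
  ∀ {n} (G : Graph n) → IsCycle G →
  ∀ (I J : Subset n) → IsPathVertexCover k G I → IsPathVertexCover k G J →
  I ≢ J →
  ∀ (u : Parameter R) (σ : State) → Loaded R u G I J σ →
  ∃₂ λ t τ → ⟨ P , σ ⟩⇓[ t ] τ × t ≤ T n ×
    Answer (ReconfigurationSequence k R u G I J) τ

infix 4 _∈O_
_∈O_ : (ℕ → ℕ) → (ℕ → ℕ) → Set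
T ∈O g = ∃₂ λ c N → ∀ n → N ≤ n → T n ≤ c * g n

SolvableOnCyclesIn : (ℕ → ℕ) → (k : ℕ) → Rule → Set₁
SolvableOnCyclesIn g k R =
  ∃₂ λ (P : Program) (T : ℕ → ℕ) → T ∈O g × SolvesOnCycles k R P T

-- Unroll the cycle to a walk indexed by ℕ.  For k ≤ n a vertex set is a cover exactly if every
-- window of k consecutive indices holds a token, that is, if its prefix counts h satisfy
-- h(i) < h(i + k); moreover h(i + n) = h(i) + s for a set of size s.  Moving a token one step ahead
-- lowers h at one residue.  If s < n < k s and another such function g lies below h, then among
-- the indices with g < h one that maximises n h(i) − s i can be lowered: each constraint that
-- could forbid this points to a further index with g < h and a larger value.  So any two covers of
-- size s are connected by slides.  If k s = n, each window of length k holds exactly one token, so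
-- covers of size s have period k and, for k < n, none of their tokens can move.
--
-- Hence TS and TJ succeed exactly if |I| = |J| and n < k |I| or n ≤ k; the linear-time test also
-- meets the quadratic bound for TS.  TAR(u), with |I| and |J| at most u, succeeds if I ∩ J is a
-- cover, and otherwise exactly if each of I and J is smaller than u or has a removable token, and
-- n ≤ k or n < k min(n, u − 1).  A token is removable exactly if it is the middle one of three
-- tokens among k + 1 consecutive indices, so that inspecting windows of constant length suffices.

module Submission where

open import Defs
open import Data.Bool.Base using (Bool; true; false; _∧_)
open import Data.Empty using (⊥)
open import Data.Fin.Base using (Fin; zero; suc; toℕ; fromℕ; fromℕ<; inject₁)
open import Data.Fin.Permutation using (Permutation′; permutation; _⟨$⟩ʳ_; _⟨$⟩ˡ_; inverseˡ; inverseʳ)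
open import Data.Fin.Properties as Fin using (toℕ-injective; toℕ-fromℕ<; toℕ<n)
open import Data.Fin.Subset using (Subset; _∈_; _⊆_; _∩_; _∪_; _─_; ⁅_⁆; ∣_∣)
  renaming (⊤ to full)
open import Data.Fin.Subset.Properties
open import Data.Nat.Base
open import Data.Nat.DivMod using (_/_; _%_; m%n<n; m≡m%n+[m/n]*n; [m+n]%n≡m%n; [m+kn]%n≡m%n; m<n⇒m%n≡m)
open import Data.Nat.Properties
open import Data.Nat.Tactic.RingSolver using (solve-∀)
open import Data.Product.Base using (Σ; ∃; ∃₂; _×_; _,_; proj₁; proj₂)
open import Data.Sum.Base using (_⊎_; inj₁; inj₂; [_,_]′)
open import Data.Unit.Base using (tt)
open import Data.Vec.Base as Vec using (Vec; lookup; _[_]≔_; _∷_; [])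
open import Data.Vec.Properties using ([]=⇒lookup; lookup⇒[]=; lookup∘update; lookup∘update′; lookup-zipWith)
open import Data.Vec.Relation.Binary.Pointwise.Extensional using (ext; Pointwise-≡⇒≡)
open import Algebra.Properties.CommutativeMonoid.Sum +-0-commutativeMonoid using (sum; sum-permute)
open import Function.Base using (_∘_; id; case_of_)
open import Function.Bundles using (Equivalence)
open import Relation.Binary.Construct.Closure.ReflexiveTransitive using (Star; ε; _◅_; _◅◅_; gmap; reverse)
  renaming (map to mapStar)
open import Relation.Binary.PropositionalEquality
open import Relation.Nullary using (Dec; yes; no; ¬_; contradiction)

-- Prefix sums and subsets of the vertex set

-- Forward slides alone suffice because a height is determined only up to a constant: raising the
-- counts of A by |A| puts them above those of B, and lowering them residue by residue ends exactly
-- at B. The sum of heights over one turn decreases with each slide, so the process stops. For n ≤ k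
-- the inequality n < k s may fail although every nonempty set is a cover; the same descent then
-- runs with n + 1 in place of k. For TAR, a slide is an addition followed by a removal, so it needs
-- one unit of space below u. If k (u - 1) ≤ n, every cover smaller than u is tight. Such a cover
-- inside the current set survives every step, so it lies in both ends of the sequence; this is why
-- I ∩ J decides that case. TS and TJ depend only on sizes, whereas TAR depends on the cyclic order,
-- which the machine has to recover from adjacency lists given in no particular order.

sumTo : (ℕ → ℕ) → ℕ → ℕ
sumTo f zero    = 0
sumTo f (suc m) = sumTo f m + f m

sumTo-cong : ∀ {f g} m → (∀ i → i < m → f i ≡ g i) → sumTo f m ≡ sumTo g m
sumTo-cong zero    f≡g = refl
sumTo-cong (suc m) f≡g =
  cong₂ _+_ (sumTo-cong m λ i i<m → f≡g i (m<n⇒m<1+n i<m)) (f≡g m ≤-refl)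

sumTo-+ : ∀ f i m → sumTo f (m + i) ≡ sumTo f i + sumTo (λ t → f (t + i)) m
sumTo-+ f i zero    = sym (+-identityʳ _)
sumTo-+ f i (suc m) = trans (cong (_+ f (m + i)) (sumTo-+ f i m)) (+-assoc (sumTo f i) _ _)

sumTo-mono-≤ : ∀ f {i j} → i ≤ j → sumTo f i ≤ sumTo f j
sumTo-mono-≤ f {i} {j} i≤j = subst (λ j → sumTo f i ≤ sumTo f j) (m∸n+n≡m i≤j)
  (subst (sumTo f i ≤_) (sym (sumTo-+ f i (j ∸ i))) (m≤m+n _ _))

sumTo-hit : ∀ f {t m} → t < m → f t ≡ 1 → sumTo f t < sumTo f m
sumTo-hit f {t} t<m ft≡1 = ≤-trans
  (≤-reflexive (trans (+-comm 1 _) (cong (sumTo f t +_) (sym ft≡1)))) (sumTo-mono-≤ f t<m)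

sumTo-miss : ∀ f m → (∀ t → t < m → f t ≡ 0) → sumTo f m ≡ 0
sumTo-miss f zero    f≡0 = refl
sumTo-miss f (suc m) f≡0 =
  cong₂ _+_ (sumTo-miss f m λ t t<m → f≡0 t (m<n⇒m<1+n t<m)) (f≡0 m ≤-refl)

-- Peels off the last 1 below `m`. The bound `c ≤ sumTo f t` allows another application below `t`,
-- so several 1s can be extracted in turn; the last clause serves where nothing may lie between `t`
-- and `m`.
sumTo-last : ∀ f → (∀ i → f i ≡ 0 ⊎ f i ≡ 1) → ∀ c m → c < sumTo f m →
  ∃ λ t → t < m × f t ≡ 1 × c ≤ sumTo f t × (∀ t′ → t < t′ → t′ < m → f t′ ≡ 0)
sumTo-last f bits c (suc m) c<Σ with bits m
... | inj₂ fm≡1 = m , ≤-refl , fm≡1 ,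
        ≤-pred (≤-trans c<Σ (≤-reflexive (trans (cong (sumTo f m +_) fm≡1) (+-comm _ 1)))) ,
        λ t′ m<t′ t′<1+m → contradiction (≤-trans m<t′ (≤-pred t′<1+m)) (<-irrefl refl)
... | inj₁ fm≡0
  with t , t<m , ft≡1 , c≤ , later ←
    sumTo-last f bits c m (≤-trans c<Σ (≤-reflexive (trans (cong (sumTo f m +_) fm≡0) (+-identityʳ _))))
  = t , m<n⇒m<1+n t<m , ft≡1 , c≤ , λ t′ t<t′ t′<1+m →
    [ (λ t′<m → later t′ t<t′ t′<m) , (λ { refl → fm≡0 }) ]′ (m≤n⇒m<n∨m≡n (≤-pred t′<1+m))

sumTo-monoʳ-< : ∀ {f g} m → (∀ i → f i ≤ g i) → ∀ {r} → r < m → f r < g r → sumTo f m < sumTo g m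
sumTo-monoʳ-< {f} {g} (suc m) f≤g {r} r<1+m fr<gr with m≤n⇒m<n∨m≡n (≤-pred r<1+m)
... | inj₁ r<m  = +-mono-<-≤ (sumTo-monoʳ-< m f≤g r<m fr<gr) (f≤g m)
... | inj₂ refl = +-mono-≤-< (below m) fr<gr
  where
  below : ∀ m → sumTo f m ≤ sumTo g m
  below zero    = z≤n
  below (suc m) = +-mono-≤ (below m) (f≤g m)

sumTo≡sum : ∀ {m} f (F : Fin m → ℕ) → (∀ i → f (toℕ i) ≡ F i) → sumTo f m ≡ sum F
sumTo≡sum {zero}  f F f≡F = refl
sumTo≡sum {suc m} f F f≡F = begin
  sumTo f (suc m)                         ≡⟨ cong (sumTo f) (+-comm 1 m) ⟩
  sumTo f (m + 1)                         ≡⟨ sumTo-+ f 1 m ⟩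
  f 0 + sumTo (λ t → f (t + 1)) m         ≡⟨ cong₂ _+_ (f≡F zero)
    (sumTo≡sum _ (F ∘ suc) λ i → trans (cong f (+-comm _ 1)) (f≡F (suc i))) ⟩
  F zero + sum (F ∘ suc)                  ∎
  where open ≡-Reasoning

sum-bits : ∀ {n} (A : Subset n) → sum (bit ∘ lookup A) ≡ ∣ A ∣
sum-bits []            = refl
sum-bits (true  ∷ A) = cong suc (sum-bits A)
sum-bits (false ∷ A) = sum-bits A

lookup-ext : ∀ {n} {A B : Subset n} → (∀ v → lookup A v ≡ lookup B v) → A ≡ B
lookup-ext A≗B = Pointwise-≡⇒≡ (ext A≗B)

⊆-lookup : ∀ {n} {A B : Subset n} → A ⊆ B → ∀ {x} → lookup A x ≡ true → lookup B x ≡ true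
⊆-lookup {A = A} A⊆B {x} x∈A = []=⇒lookup (A⊆B (lookup⇒[]= x A x∈A))

lookup-⊆ : ∀ {n} {A B : Subset n} → (∀ x → lookup A x ≡ true → lookup B x ≡ true) → A ⊆ B
lookup-⊆ {B = B} A⊆B {x} x∈A = lookup⇒[]= x B (A⊆B x ([]=⇒lookup x∈A))

lookup-⁅x⁆-≢ : ∀ {n} {x v : Fin n} → v ≢ x → lookup ⁅ x ⁆ v ≡ false
lookup-⁅x⁆-≢ {x = x} {v} v≢x with lookup ⁅ x ⁆ v in eq
... | true  = contradiction (lookup⇒[]= v ⁅ x ⁆ eq) (x≢y⇒x∉⁅y⁆ v≢x)
... | false = refl

insert-⊇ : ∀ {n} (A : Subset n) x → A ⊆ A [ x ]≔ true
insert-⊇ A x = lookup-⊆ λ v v∈A → case v Fin.≟ x of λ where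
  (yes refl) → lookup∘update x A true
  (no v≢x)   → trans (lookup∘update′ v≢x A true) v∈A

∣insert∣ : ∀ {n} (A : Subset n) x → lookup A x ≡ false → ∣ A [ x ]≔ true ∣ ≡ suc ∣ A ∣
∣insert∣ (false ∷ A) zero    x∉A = refl
∣insert∣ (true  ∷ A) (suc x) x∉A = cong suc (∣insert∣ A x x∉A)
∣insert∣ (false ∷ A) (suc x) x∉A = ∣insert∣ A x x∉A

∣remove∣ : ∀ {n} (A : Subset n) x → lookup A x ≡ true → suc ∣ A [ x ]≔ false ∣ ≡ ∣ A ∣
∣remove∣ (true  ∷ A) zero    x∈A = refl
∣remove∣ (true  ∷ A) (suc x) x∈A = cong suc (∣remove∣ A x x∈A)
∣remove∣ (false ∷ A) (suc x) x∈A = ∣remove∣ A x x∈A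

-- Both sides count the union of `A` and `B`.
∣exchange∣ : ∀ {n} (A B : Subset n) → ∣ A ∣ + ∣ B ─ A ∣ ≡ ∣ B ∣ + ∣ A ─ B ∣
∣exchange∣ []          []          = refl
∣exchange∣ (true  ∷ A) (true  ∷ B) = cong suc (∣exchange∣ A B)
∣exchange∣ (true  ∷ A) (false ∷ B) = trans (cong suc (∣exchange∣ A B)) (sym (+-suc _ _))
∣exchange∣ (false ∷ A) (true  ∷ B) = trans (+-suc _ _) (cong suc (∣exchange∣ A B))
∣exchange∣ (false ∷ A) (false ∷ B) = ∣exchange∣ A B

lookup-─ : ∀ {n} (A B : Subset n) v → lookup A v ≡ true → lookup B v ≡ false → lookup (A ─ B) v ≡ true
lookup-─ (true ∷ A) (false ∷ B) zero    v∈A v∉B = refl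
lookup-─ (_    ∷ A) (_     ∷ B) (suc v) v∈A v∉B = lookup-─ A B v v∈A v∉B

lookup-─-same : ∀ {n} (A B : Subset n) v → lookup A v ≡ lookup B v → lookup (A ─ B) v ≡ false
lookup-─-same (true  ∷ A) (true  ∷ B) zero    eq = refl
lookup-─-same (false ∷ A) (false ∷ B) zero    eq = refl
lookup-─-same (_     ∷ A) (_     ∷ B) (suc v) eq = lookup-─-same A B v eq

lookup-─-∉ : ∀ {n} (A B : Subset n) v → lookup A v ≡ false → lookup (A ─ B) v ≡ false
lookup-─-∉ (false ∷ A) (true  ∷ B) zero    v∉A = refl
lookup-─-∉ (false ∷ A) (false ∷ B) zero    v∉A = refl
lookup-─-∉ (_     ∷ A) (_     ∷ B) (suc v) v∉A = lookup-─-∉ A B v v∉A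

slide : ∀ {n} → Subset n → Fin n → Fin n → Subset n
slide A x y = (A [ x ]≔ false) [ y ]≔ true

module _ {n} (A : Subset n) {x y : Fin n} (x∈A : lookup A x ≡ true) (y∉A : lookup A y ≡ false) where

  slide-≢ : x ≢ y
  slide-≢ refl = case trans (sym x∈A) y∉A of λ ()

  lookup-slide-source : lookup (slide A x y) x ≡ false
  lookup-slide-source = trans (lookup∘update′ slide-≢ (A [ x ]≔ false) true) (lookup∘update x A false)

  lookup-slide-target : lookup (slide A x y) y ≡ true
  lookup-slide-target = lookup∘update y (A [ x ]≔ false) true

  lookup-slide-other : ∀ {v} → v ≢ x → v ≢ y → lookup (slide A x y) v ≡ lookup A v
  lookup-slide-other v≢x v≢y =
    trans (lookup∘update′ v≢y (A [ x ]≔ false) true) (lookup∘update′ v≢x A false)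

  lost-by-slide : A ─ slide A x y ≡ ⁅ x ⁆
  lost-by-slide = lookup-ext λ v → case v Fin.≟ x of λ where
    (yes refl) → trans (lookup-─ A _ x x∈A lookup-slide-source) (sym ([]=⇒lookup (x∈⁅x⁆ x)))
    (no v≢x) → trans (case v Fin.≟ y of λ where
        (yes refl) → lookup-─-∉ A _ y y∉A
        (no v≢y)   → lookup-─-same A _ v (sym (lookup-slide-other v≢x v≢y)))
      (sym (lookup-⁅x⁆-≢ v≢x))

  gained-by-slide : slide A x y ─ A ≡ ⁅ y ⁆
  gained-by-slide = lookup-ext λ v → case v Fin.≟ y of λ where
    (yes refl) → trans (lookup-─ (slide A x y) A y lookup-slide-target y∉A) (sym ([]=⇒lookup (x∈⁅x⁆ y)))
    (no v≢y) → trans (case v Fin.≟ x of λ where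
        (yes refl) → lookup-─-∉ (slide A x y) A x lookup-slide-source
        (no v≢x)   → lookup-─-same (slide A x y) A v (lookup-slide-other v≢x v≢y))
      (sym (lookup-⁅x⁆-≢ v≢y))

-- Symmetric differences of size one and chains of them

Flip : ∀ {n} → Subset n → Subset n → Set
Flip A B = ∣ (A ─ B) ∪ (B ─ A) ∣ ≡ 1

Flip-sym : ∀ {n} {A B : Subset n} → Flip A B → Flip B A
Flip-sym {A = A} {B} = trans (cong ∣_∣ (∪-comm (B ─ A) (A ─ B)))

Δ-self : ∀ {n} (A : Subset n) → ∣ (A ─ A) ∪ (A ─ A) ∣ ≡ 0
Δ-self []          = refl
Δ-self (true  ∷ A) = Δ-self A
Δ-self (false ∷ A) = Δ-self A

Δ-empty : ∀ {n} (A B : Subset n) → ∣ (A ─ B) ∪ (B ─ A) ∣ ≡ 0 → A ≡ B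
Δ-empty []          []          eq = refl
Δ-empty (true  ∷ A) (true  ∷ B) eq = cong (true ∷_) (Δ-empty A B eq)
Δ-empty (false ∷ A) (false ∷ B) eq = cong (false ∷_) (Δ-empty A B eq)

Flip-cases : ∀ {n} (A B : Subset n) → Flip A B →
  ∃ λ x → (lookup A x ≡ false × B ≡ A [ x ]≔ true) ⊎ (lookup A x ≡ true × B ≡ A [ x ]≔ false)
Flip-cases []          []          ()
Flip-cases (true  ∷ A) (false ∷ B) eq = zero , inj₂ (refl , cong (false ∷_) (sym (Δ-empty A B (suc-injective eq))))
Flip-cases (false ∷ A) (true  ∷ B) eq = zero , inj₁ (refl , cong (true ∷_) (sym (Δ-empty A B (suc-injective eq))))
Flip-cases (true  ∷ A) (true  ∷ B) eq with Flip-cases A B eq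
... | x , inj₁ (x∉A , B≡) = suc x , inj₁ (x∉A , cong (true ∷_) B≡)
... | x , inj₂ (x∈A , B≡) = suc x , inj₂ (x∈A , cong (true ∷_) B≡)
Flip-cases (false ∷ A) (false ∷ B) eq with Flip-cases A B eq
... | x , inj₁ (x∉A , B≡) = suc x , inj₁ (x∉A , cong (false ∷_) B≡)
... | x , inj₂ (x∈A , B≡) = suc x , inj₂ (x∈A , cong (false ∷_) B≡)

-- Both ends of a flip are kept between `A` and `B`: containing `A` preserves the covering property,
-- lying in `B` preserves the size bound.
FlipBetween : ∀ {n} → Subset n → Subset n → Subset n → Subset n → Set
FlipBetween A B C D = (A ⊆ C × C ⊆ B) × Flip C D × (A ⊆ D × D ⊆ B)

-- The head `s` of the lower bound may differ from the common head `t` of the sets: once a head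
-- vertex has been inserted, all later sets contain it while `A` does not.
FlipBetween-∷ : ∀ {n s t} {A B C D : Subset n} → (∀ {C} → A ⊆ C → s ∷ A ⊆ t ∷ C) →
  FlipBetween A B C D → FlipBetween (s ∷ A) (t ∷ B) (t ∷ C) (t ∷ D)
FlipBetween-∷ {t = true}  lower ((l , r) , f , (l′ , r′)) =
  ((λ {_} → lower l) , (λ {_} → s⊆s r)) , f , ((λ {_} → lower l′) , (λ {_} → s⊆s r′))
FlipBetween-∷ {t = false} lower ((l , r) , f , (l′ , r′)) =
  ((λ {_} → lower l) , (λ {_} → s⊆s r)) , f , ((λ {_} → lower l′) , (λ {_} → s⊆s r′))

fill : ∀ {n} (A B : Subset n) → A ⊆ B → Star (FlipBetween A B) A B
fill []          []          A⊆B = ε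
fill (true  ∷ A) (true  ∷ B) A⊆B = gmap (true ∷_) (FlipBetween-∷ s⊆s) (fill A B (drop-∷-⊆ A⊆B))
fill (false ∷ A) (false ∷ B) A⊆B = gmap (false ∷_) (FlipBetween-∷ s⊆s) (fill A B (drop-∷-⊆ A⊆B))
fill (true  ∷ A) (false ∷ B) A⊆B = case A⊆B Vec.here of λ ()
fill (false ∷ A) (true  ∷ B) A⊆B =
  (((λ {_} → id) , (λ {_} → A⊆B)) , cong suc (Δ-self A) , ((λ {_} → out⊆ id) , (λ {_} → s⊆s (drop-∷-⊆ A⊆B)))) ◅
  gmap (true ∷_) (FlipBetween-∷ out⊆) (fill A B (drop-∷-⊆ A⊆B))

grow : ∀ {n} (A : Subset n) s → ∣ A ∣ ≤ s → s ≤ n → ∃ λ B → A ⊆ B × ∣ B ∣ ≡ s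
grow []          zero    ∣A∣≤s s≤n = [] , id , refl
grow (true ∷ A)  (suc s) ∣A∣≤s s≤n with B , A⊆B , eq ← grow A s (≤-pred ∣A∣≤s) (≤-pred s≤n)
  = true ∷ B , s⊆s A⊆B , cong suc eq
grow {suc n} (false ∷ A) s ∣A∣≤s s≤n with m≤n⇒m<n∨m≡n s≤n
... | inj₂ refl = full , ⊆⊤ , ∣⊤∣≡n (suc n)
... | inj₁ s<n with B , A⊆B , eq ← grow A s ∣A∣≤s (≤-pred s<n) = false ∷ B , s⊆s A⊆B , eq

-- Walks around a cycle

-- A vertex numbering of a cycle unrolled along the cycle: indices that agree modulo n name the
-- same vertex.
record Walk {n} (G : Graph n) : Set where
  open Graph G
  field
    large      : 3 ≤ n
    at         : ℕ → Fin n
    periodic   : ∀ i → at (n + i) ≡ at i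
    distinct   : ∀ {i t} → t < n → at i ≡ at (t + i) → t ≡ 0
    onto       : ∀ v → ∃ λ i → at i ≡ v
    adjacent   : ∀ i → Adj (at i) (at (suc i))
    neighbours : ∀ i {w} → Adj (at (suc i)) w → w ≡ at i ⊎ w ≡ at (2+ i)

module WalkProperties {n} {G : Graph n} (W : Walk G) where
  open Graph G using (Adj)
  open Walk W public

  instance
    order-nonZero : NonZero n
    order-nonZero = >-nonZero (≤-trans (s≤s z≤n) large)

  periodic* : ∀ q i → at (q * n + i) ≡ at i
  periodic* zero    i = refl
  periodic* (suc q) i = trans (cong at (+-assoc n (q * n) i)) (trans (periodic _) (periodic* q i))

  index-split : ∀ i → i ≡ i / n * n + i % n
  index-split i = trans (m≡m%n+[m/n]*n i n) (+-comm (i % n) _)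

  lift : (X : ℕ → Set) → (∀ {i} → X i → X (n + i)) → ∀ q {r} → X r → X (q * n + r)
  lift X up zero    Xr = Xr
  lift X up (suc q) Xr = subst X (sym (+-assoc n (q * n) _)) (up (lift X up q Xr))

  everywhere : (X : ℕ → Set) → (∀ {i} → X i → X (n + i)) → (∀ r → r < n → X r) → ∀ i → X i
  everywhere X up base i = subst X (sym (index-split i)) (lift X up (i / n) (base _ (m%n<n i n)))

  same-residue : ∀ {i j} → i ≤ j → at i ≡ at j → ∃ λ q → j ≡ q * n + i
  same-residue {i} {j} i≤j eq = d / n , trans j≡ (cong (_+ (d / n * n + i)) r≡0)
    where
    d = j ∸ i
    j≡ : j ≡ d % n + (d / n * n + i)
    j≡ = trans (sym (m∸n+n≡m i≤j)) (trans (cong (_+ i) (m≡m%n+[m/n]*n d n)) (+-assoc (d % n) _ i))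
    r≡0 : d % n ≡ 0
    r≡0 = distinct {i = d / n * n + i} (m%n<n d n) (trans (periodic* (d / n) i) (trans eq (cong at j≡)))

  -- Two indices of one vertex differ by whole turns, in either order, so the property must survive
  -- a turn both forwards and backwards.
  respects : (X : ℕ → Set) → (∀ {i} → X i → X (n + i)) → (∀ {i} → X (n + i) → X i) →
    ∀ {i j} → at i ≡ at j → X i → X j
  respects X up down {i} {j} eq Xi = [ above , below ]′ (≤-total i j)
    where
    drop : ∀ q {r} → X (q * n + r) → X r
    drop zero    Xr = Xr
    drop (suc q) Xr = drop q (down (subst X (+-assoc n (q * n) _) Xr))
    above : i ≤ j → X j
    above i≤j with q , refl ← same-residue i≤j eq = lift X up q Xi
    below : j ≤ i → X j
    below j≤i with q , refl ← same-residue j≤i (sym eq) = drop q Xi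

  swap-+ : ∀ a b c → a + (b + c) ≡ b + (a + c)
  swap-+ = solve-∀

  shift : ∀ t {i j} → at i ≡ at j → at (t + i) ≡ at (t + j)
  shift t {i} {j} eq = respects (λ x → at (t + i) ≡ at (t + x))
    (λ {x} e → trans e (sym (n-out x))) (λ {x} e → trans e (n-out x)) eq refl
    where
    n-out : ∀ x → at (t + (n + x)) ≡ at (t + x)
    n-out x = trans (cong at (swap-+ t n x)) (periodic (t + x))

  -- A further shift by `t * pred n` completes `t` whole turns: modulo n it subtracts `t`.
  unshift : ∀ t {i j} → at (t + i) ≡ at (t + j) → at i ≡ at j
  unshift t {i} {j} eq = trans (sym (full-turns i)) (trans (shift (t * pred n) eq) (full-turns j))
    where
    turn : ∀ t p i → t * p + (t + i) ≡ t * suc p + i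
    turn = solve-∀
    full-turns : ∀ i → at (t * pred n + (t + i)) ≡ at i
    full-turns i = trans (cong at (trans (turn t (pred n) i) (cong (λ x → t * x + i) (suc-pred n)))) (periodic* t i)

  apart : ∀ {i t} → 0 < t → t < n → at (t + i) ≢ at i
  apart 0<t t<n eq = contradiction (sym (distinct t<n (sym eq))) (<⇒≢ 0<t)

  token : Subset n → ℕ → ℕ
  token A i = bit (lookup A (at i))

  token-periodic : ∀ A i → token A (n + i) ≡ token A i
  token-periodic A i = cong (bit ∘ lookup A) (periodic i)

  -- One turn visits every vertex once. As a permutation this converts a sum along the walk into a
  -- sum over the vertices.
  numbering : Permutation′ n
  numbering = permutation (at ∘ toℕ) index at∘index index∘at
    where
    index : Fin n → Fin n
    index v = fromℕ< (m%n<n (proj₁ (onto v)) n)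
    at∘index : ∀ v → at (toℕ (index v)) ≡ v
    at∘index v with i , eq ← onto v = trans (cong at (toℕ-fromℕ< (m%n<n i n)))
      (trans (sym (trans (cong at (index-split i)) (periodic* (i / n) (i % n)))) eq)
    no-alias : ∀ {a b} → a < n → b < n → a ≤ b → at a ≡ at b → a ≡ b
    no-alias {a} {b} a<n b<n a≤b eq = ≤-antisym a≤b (m∸n≡0⇒m≤n
      (distinct {i = a} (≤-<-trans (m∸n≤m b a) b<n) (trans eq (cong at (sym (m∸n+n≡m a≤b))))))
    index∘at : ∀ i → index (at (toℕ i)) ≡ i
    index∘at i = toℕ-injective ([ (λ le → no-alias (toℕ<n _) (toℕ<n i) le (at∘index _))
                                , (λ le → sym (no-alias (toℕ<n i) (toℕ<n _) le (sym (at∘index _)))) ]′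
                                (≤-total (toℕ (index (at (toℕ i)))) (toℕ i)))

  tokens-per-turn : ∀ A → sumTo (token A) n ≡ ∣ A ∣
  tokens-per-turn A = trans (sumTo≡sum {n} (token A) (bit ∘ lookup A ∘ at ∘ toℕ) λ _ → refl)
    (trans (sym (sum-permute {n} {n} (bit ∘ lookup A) numbering)) (sum-bits A))

  tokens-turn : ∀ A i → sumTo (token A) (n + i) ≡ ∣ A ∣ + sumTo (token A) i
  tokens-turn A i = begin
    sumTo (token A) (n + i)                                         ≡⟨ cong (sumTo (token A)) (+-comm n i) ⟩
    sumTo (token A) (i + n)                                         ≡⟨ sumTo-+ (token A) n i ⟩
    sumTo (token A) n + sumTo (λ t → token A (t + n)) i             ≡⟨ cong₂ _+_ (tokens-per-turn A)
      (sumTo-cong i λ t _ → trans (cong (token A) (+-comm t n)) (token-periodic A t)) ⟩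
    ∣ A ∣ + sumTo (token A) i                                       ∎
    where open ≡-Reasoning

  complement : ∀ a i → at (a * pred n + i + a) ≡ at i
  complement a i = trans (cong at (trans (turn a (pred n) i) (cong (λ x → a * x + i) (suc-pred n))))
                         (periodic* a i)
    where
    turn : ∀ a p i → a * p + i + a ≡ a * suc p + i
    turn = solve-∀

  rotate : ℕ → Walk G
  rotate a = record
    { large      = large
    ; at         = λ i → at (i + a)
    ; periodic   = λ i → trans (cong at (+-assoc n i a)) (periodic (i + a))
    ; distinct   = λ {i} {t} t<n eq → distinct t<n (trans eq (cong at (+-assoc t i a)))
    ; onto       = λ v → case onto v of λ where
        (i , eq) → a * pred n + i , trans (complement a i) eq
    ; adjacent   = λ i → adjacent (i + a)
    ; neighbours = λ i → neighbours (i + a)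
    }

-- Here `m` is -1 modulo n, so multiplying the index by `m` reverses the direction without any
-- subtraction; the new walk starts at the old index `a`.
reflect : ∀ {n} {G : Graph n} → Walk G → ℕ → Walk G
reflect {zero}  W a = contradiction (Walk.large W) λ ()
reflect {suc zero}  W a = contradiction (Walk.large W) λ { (s≤s ()) }
reflect {suc m@(suc m′)} {G} W a = record
  { large      = large
  ; at         = λ i → at (i * m + a)
  ; periodic   = λ i → trans (cong at (turn i m a)) (periodic* m (i * m + a))
  ; distinct   = λ {i} {t} t<n eq → distinct t<n (sym (trans
                   (shift t eq) (trans (cong at (turn′ t i m a)) (periodic* t (i * m + a)))))
  ; onto       = λ v → case onto v of λ where
      -- Modulo n the witness is a - i, which the reversed numbering sends to i.
      (i , eq) → a + i * m , trans (unshift (a + i * m) {(a + i * m) * m + a} {i} (begin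
          at (a + i * m + ((a + i * m) * m + a)) ≡⟨ cong at (turn₁ a i m) ⟩
          at ((a + i * m) * suc m + a)           ≡⟨ periodic* (a + i * m) a ⟩
          at a                                   ≡⟨ periodic* i a ⟨
          at (i * suc m + a)                     ≡⟨ cong at (turn₂ a i m) ⟩
          at (a + i * m + i)                     ∎)) eq
  ; adjacent   = λ i → subst (Adj (at (i * m + a))) (cong at (sym (+-assoc m (i * m) a)))
                   (Graph.sym G (subst (Adj (at (m + (i * m + a)))) (periodic _) (adjacent _)))
  ; neighbours = λ i {w} Adj-w → case neighbours _ (subst (λ x → Adj (at x) w) (+-assoc m (i * m) a) Adj-w) of λ where
      (inj₁ eq) → inj₂ (trans eq (sym (trans (cong at (turn₃ m′ i a)) (periodic _))))
      (inj₂ eq) → inj₁ (trans eq (periodic _))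
  }
  where
  open WalkProperties W
  open Graph G using (Adj)
  open ≡-Reasoning
  turn : ∀ i m a → (suc m + i) * m + a ≡ m * suc m + (i * m + a)
  turn = solve-∀
  turn′ : ∀ t i m a → t + ((t + i) * m + a) ≡ t * suc m + (i * m + a)
  turn′ = solve-∀
  turn₁ : ∀ a i m → a + i * m + ((a + i * m) * m + a) ≡ (a + i * m) * suc m + a
  turn₁ = solve-∀
  turn₂ : ∀ a i m → i * suc m + a ≡ a + i * m + i
  turn₂ = solve-∀
  turn₃ : ∀ m′ i a → (2 + i) * suc m′ + a ≡ (2 + m′) + (m′ + (i * suc m′ + a))
  turn₃ = solve-∀

CyclicNext-functional : ∀ {n} {i j j′ : Fin n} → CyclicNext i j → CyclicNext i j′ → j ≡ j′
CyclicNext-functional (inj₁ p) (inj₁ q) = toℕ-injective (trans p (sym q))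
CyclicNext-functional {j = j} (inj₁ p) (inj₂ (q , _)) = contradiction (trans p q) (<⇒≢ (toℕ<n j))
CyclicNext-functional {j′ = j′} (inj₂ (p , _)) (inj₁ q) = contradiction (trans q p) (<⇒≢ (toℕ<n j′))
CyclicNext-functional (inj₂ (_ , p)) (inj₂ (_ , q)) = toℕ-injective (trans p (sym q))

CyclicNext-injective : ∀ {n} {i i′ j : Fin n} → CyclicNext i j → CyclicNext i′ j → i ≡ i′
CyclicNext-injective (inj₁ p) (inj₁ q) = toℕ-injective (suc-injective (trans (sym p) q))
CyclicNext-injective (inj₁ p) (inj₂ (_ , q)) = case trans (sym p) q of λ ()
CyclicNext-injective (inj₂ (_ , p)) (inj₁ q) = case trans (sym q) p of λ ()
CyclicNext-injective (inj₂ (p , _)) (inj₂ (q , _)) = toℕ-injective (suc-injective (trans p (sym q)))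

cycleWalk : ∀ {n} {G : Graph n} → IsCycle G → Walk G
cycleWalk {n} {G} (3≤n , π , iff) = record
  { large      = 3≤n
  ; at         = at
  ; periodic   = λ i → cong (π ⟨$⟩ʳ_) (Fin.fromℕ<-cong _ _ (trans (cong (_% n) (+-comm n i)) ([m+n]%n≡m%n i n)) _ _)
  ; distinct   = λ {i} {t} t<n eq → distinct i t t<n (trans (sym (toℕ-fromℕ< _)) (trans (cong toℕ (π-injective eq)) (toℕ-fromℕ< _)))
  ; onto       = λ v → toℕ (π ⟨$⟩ˡ v) , trans
      (cong (π ⟨$⟩ʳ_) (toℕ-injective (trans (toℕ-fromℕ< _) (m<n⇒m%n≡m (toℕ<n _))))) (inverseʳ π)
  ; adjacent   = λ i → Equivalence.from (iff _ _) (inj₁ (next i))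
  ; neighbours = neighbours
  }
  where
  open Graph G using (Adj)
  instance
    n≢0 : NonZero n
    n≢0 = >-nonZero (≤-trans (s≤s z≤n) 3≤n)
  res : ℕ → Fin n
  res i = fromℕ< (m%n<n i n)
  at : ℕ → Fin n
  at i = π ⟨$⟩ʳ res i
  π-injective : ∀ {x y} → π ⟨$⟩ʳ x ≡ π ⟨$⟩ʳ y → x ≡ y
  π-injective eq = trans (sym (inverseˡ π)) (trans (cong (π ⟨$⟩ˡ_) eq) (inverseˡ π))
  %-+ : ∀ t i → (t + i) % n ≡ (t + i % n) % n
  %-+ t i = trans (cong (_% n) (trans (cong (t +_) (m≡m%n+[m/n]*n i n)) (sym (+-assoc t (i % n) _))))
                  ([m+kn]%n≡m%n (t + i % n) (i / n) n)
  wrap : ∀ {x} → n ≤ x → x < n + n → x % n ≡ x ∸ n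
  wrap {x} n≤x x<2n = trans (cong (_% n) (sym (m∸n+n≡m n≤x))) (trans ([m+n]%n≡m%n (x ∸ n) n)
    (m<n⇒m%n≡m (+-cancelʳ-< n _ _ (subst (_< n + n) (sym (m∸n+n≡m n≤x)) x<2n))))
  distinct : ∀ i t → t < n → i % n ≡ (t + i) % n → t ≡ 0
  distinct i t t<n eq with (t + i % n) <? n
  ... | yes small = +-cancelʳ-≡ (i % n) t 0 (sym (trans eq (trans (%-+ t i) (m<n⇒m%n≡m small))))
  ... | no large = contradiction
        (+-cancelˡ-≡ (i % n) _ _ (trans (cong (_+ n) (trans eq (trans (%-+ t i) (wrap n≤ (+-mono-< t<n (m%n<n i n))))))
          (trans (m∸n+n≡m n≤) (+-comm t _))))
        (<⇒≢ t<n ∘ sym)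
    where n≤ = ≮⇒≥ large
  next : ∀ i → CyclicNext (res i) (res (suc i))
  next i with m≤n⇒m<n∨m≡n (m%n<n i n)
  ... | inj₁ small = inj₁ (trans (toℕ-fromℕ< _) (trans (%-+ 1 i) (trans (m<n⇒m%n≡m small)
          (cong suc (sym (toℕ-fromℕ< _))))))
  ... | inj₂ end = inj₂ (trans (cong suc (toℕ-fromℕ< _)) end , trans (toℕ-fromℕ< _) (trans (%-+ 1 i)
          (trans (wrap (≤-reflexive (sym end)) (subst (_< n + n) (sym end) (m<m+n n (>-nonZero⁻¹ n))))
            (m≤n⇒m∸n≡0 (≤-reflexive end)))))
  neighbours : ∀ i {w} → Adj (at (suc i)) w → w ≡ at i ⊎ w ≡ at (2+ i)
  neighbours i {w} adj with Equivalence.to (iff (res (suc i)) (π ⟨$⟩ˡ w)) (subst (Adj _) (sym (inverseʳ π)) adj)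
  ... | inj₁ after  = inj₂ (trans (sym (inverseʳ π)) (cong (π ⟨$⟩ʳ_) (CyclicNext-functional after (next (suc i)))))
  ... | inj₂ before = inj₁ (trans (sym (inverseʳ π)) (cong (π ⟨$⟩ʳ_) (CyclicNext-injective before (next i))))

-- The machine sets out towards whichever neighbour is listed first, so the walk that describes its
-- run may have to go round the cycle in reverse.
walkAlong : ∀ {n} {G : Graph n} → IsCycle G → ∀ {v w} → Graph.Adj G v w →
  Σ (Walk G) λ W → Walk.at W 0 ≡ v × Walk.at W 1 ≡ w
-- Adding a full turn makes the index positive, so that it has a predecessor.
walkAlong {n} {G} cycle {v} {w} adj = from-index (n + proj₁ (onto v)) (trans (periodic _) (proj₂ (onto v))) (≤-trans (s≤s z≤n) (≤-trans large (m≤m+n n _)))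
  where
  W = cycleWalk {G = G} cycle
  open WalkProperties W
  backwards : ∀ {n} {G : Graph n} (W : Walk G) i → Walk.at (reflect W (suc i)) 0 ≡ Walk.at W (suc i) ×
    Walk.at (reflect W (suc i)) 1 ≡ Walk.at W i
  backwards {zero}  W i = contradiction (Walk.large W) λ ()
  backwards {suc zero}  W i = contradiction (Walk.large W) λ { (s≤s ()) }
  backwards {2+ m} W i = refl , trans (cong (Walk.at W) (step m i)) (Walk.periodic W i)
    where
    step : ∀ m i → 1 * suc m + suc i ≡ 2 + m + i
    step = solve-∀
  from-index : ∀ i → at i ≡ v → 0 < i → Σ (Walk G) λ W → Walk.at W 0 ≡ v × Walk.at W 1 ≡ w
  from-index (suc i) eq _ with neighbours i (subst (λ v → Graph.Adj G v w) (sym eq) adj)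
  ... | inj₁ w≡ = reflect W (suc i) , trans (proj₁ (backwards W i)) eq , trans (proj₂ (backwards W i)) (sym w≡)
  ... | inj₂ w≡ = rotate (suc i) , eq , sym w≡

-- Windows, covers and heights

bits : ∀ b → bit b ≡ 0 ⊎ bit b ≡ 1
bits true  = inj₂ refl
bits false = inj₁ refl

bit-injective : ∀ {a b} → bit a ≡ bit b → a ≡ b
bit-injective {true}  {true}  _ = refl
bit-injective {false} {false} _ = refl

bit≡1 : ∀ {b} → bit b ≡ 1 → b ≡ true
bit≡1 {true} _ = refl

bit≡0 : ∀ {b} → bit b ≡ 0 → b ≡ false
bit≡0 {false} _ = refl

argmax : ∀ {D : ℕ → Set} → (∀ i → Dec (D i)) → ∀ (φ : ℕ → ℕ) m →
  (∀ r → r < m → ¬ D r) ⊎ ∃ λ r → r < m × D r × (∀ r′ → r′ < m → D r′ → φ r′ ≤ φ r)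
argmax D? φ zero = inj₁ λ _ ()
argmax {D} D? φ (suc m) with argmax D? φ m | D? m
... | inj₁ none | no ¬Dm = inj₁ λ r r<1+m → [ none r , (λ { refl → ¬Dm }) ]′ (m≤n⇒m<n∨m≡n (≤-pred r<1+m))
... | inj₁ none | yes Dm = inj₂ (m , ≤-refl , Dm , λ r r<1+m Dr →
        [ (λ r<m → contradiction Dr (none r r<m)) , (λ { refl → ≤-refl }) ]′ (m≤n⇒m<n∨m≡n (≤-pred r<1+m)))
... | inj₂ (r , r<m , Dr , max) | no ¬Dm = inj₂ (r , m<n⇒m<1+n r<m , Dr , λ r′ r′<1+m Dr′ →
        [ (λ r′<m → max r′ r′<m Dr′) , (λ { refl → contradiction Dr′ ¬Dm }) ]′ (m≤n⇒m<n∨m≡n (≤-pred r′<1+m)))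
... | inj₂ (r , r<m , Dr , max) | yes Dm with ≤-total (φ r) (φ m)
...   | inj₁ r≤m = inj₂ (m , ≤-refl , Dm , λ r′ r′<1+m Dr′ →
          [ (λ r′<m → ≤-trans (max r′ r′<m Dr′) r≤m) , (λ { refl → ≤-refl }) ]′ (m≤n⇒m<n∨m≡n (≤-pred r′<1+m)))
...   | inj₂ m≤r = inj₂ (r , m<n⇒m<1+n r<m , Dr , λ r′ r′<1+m Dr′ →
          [ (λ r′<m → max r′ r′<m Dr′) , (λ { refl → m≤r }) ]′ (m≤n⇒m<n∨m≡n (≤-pred r′<1+m)))

module Windows {n} {G : Graph n} (W : Walk G) where
  open WalkProperties W public
  open Graph G using (Adj)

  Hits : ℕ → Subset n → Set
  Hits k A = ∀ i → ∃ λ t → t < k × lookup A (at (t + i)) ≡ true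

  window : ℕ → Subset n → ℕ → ℕ
  window k A i = sumTo (λ t → token A (t + i)) k

  hit⇒window : ∀ k A i → (∃ λ t → t < k × lookup A (at (t + i)) ≡ true) → 0 < window k A i
  hit⇒window k A i (t , t<k , e) = ≤-<-trans z≤n (sumTo-hit (λ t → token A (t + i)) t<k (cong bit e))

  window⇒hit : ∀ k A i → 0 < window k A i → ∃ λ t → t < k × lookup A (at (t + i)) ≡ true
  window⇒hit k A i pos
    with t , t<k , e , _ ← sumTo-last (λ t → token A (t + i)) (λ _ → bits _) 0 k pos = t , t<k , bit≡1 e

  injectiveʷ : ∀ {i a b} → a < n → b < n → at (a + i) ≡ at (b + i) → a ≡ b
  injectiveʷ {i} {a} {b} a<n b<n eq = [ (λ le → ordered le b<n eq) , (λ le → sym (ordered le a<n (sym eq))) ]′ (≤-total a b)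
    where
    ordered : ∀ {a b} → a ≤ b → b < n → at (a + i) ≡ at (b + i) → a ≡ b
    ordered {a} {b} a≤b b<n eq = ≤-antisym a≤b (m∸n≡0⇒m≤n (distinct {i = a + i} (≤-<-trans (m∸n≤m b a) b<n)
      (trans eq (cong at (trans (cong (_+ i) (sym (m∸n+n≡m a≤b))) (+-assoc (b ∸ a) a i))))))

  cover⇒Hits : ∀ {k} A → k ≤ n → IsPathVertexCover k G A → Hits k A
  cover⇒Hits {k} A k≤n cover i with t , e ← cover (record
    { vertex    = λ t → at (toℕ t + i)
    ; injective = λ {a} {b} eq → toℕ-injective (injectiveʷ (<-≤-trans (toℕ<n a) k≤n) (<-≤-trans (toℕ<n b) k≤n) eq)
    ; adjacent  = λ {a} {b} eq → subst (λ x → Adj _ (at (x + i))) (sym eq) (adjacent (toℕ a + i))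
    }) = toℕ t , toℕ<n t , []=⇒lookup e

  -- A path cannot turn back, so it runs along a window, in one direction or the other.
  Hits⇒cover : ∀ {k} A → 2 ≤ k → Hits k A → IsPathVertexCover k G A
  Hits⇒cover {1} A (s≤s ())
  Hits⇒cover {k@(2+ k′)} A 2≤k hits path = start (onto (vertex zero))
    where
    open Path path renaming (adjacent to edge)
    found : ∀ {t v} → t < k → (∀ x → toℕ x ≡ t → vertex x ≡ v) → lookup A v ≡ true → ∃ λ x → vertex x ∈ A
    found t<k eq e = fromℕ< t<k , lookup⇒[]= _ A (trans (cong (lookup A) (eq _ (toℕ-fromℕ< t<k))) e)
    no-return : ∀ {j x z} → toℕ x ≡ j → toℕ z ≡ 2 + j → vertex z ≢ vertex x
    no-return refl ez eq = contradiction (trans (sym (cong toℕ (injective eq))) ez) (<⇒≢ (m<n⇒m<1+n ≤-refl))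
    below : ∀ {j} {x : Fin k} → toℕ x ≡ suc j → ∃ λ (w : Fin k) → toℕ w ≡ j
    below {x = x} e = fromℕ< (<-trans ≤-refl (subst (_< k) e (toℕ<n x))) , toℕ-fromℕ< _
    module _ {b} (e₀ : vertex zero ≡ at b) (e₁ : vertex (suc zero) ≡ at (suc b)) where
      forward : ∀ j {x y} → toℕ x ≡ j → toℕ y ≡ suc j → vertex x ≡ at (j + b) × vertex y ≡ at (suc j + b)
      forward zero ex ey = trans (cong vertex (toℕ-injective ex)) e₀ , trans (cong vertex (toℕ-injective ey)) e₁
      forward (suc j) {x} {y} ex ey with w , ew ← below ex with forward j ew ex
      ... | w≡ , x≡ with neighbours (j + b) (subst (λ v → Adj v (vertex y)) x≡ (edge (trans ey (cong suc (sym ex)))))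
      ...   | inj₁ back = contradiction (trans back (sym w≡)) (no-return ew ey)
      ...   | inj₂ y≡   = x≡ , y≡
      forward-at : ∀ t x → toℕ x ≡ t → vertex x ≡ at (t + b)
      forward-at zero x ex = proj₁ (forward zero ex refl)
      forward-at (suc t) x ex with w , ew ← below ex = proj₂ (forward t ew ex)
    module _ {c} (e₀ : vertex zero ≡ at (suc c)) (e₁ : vertex (suc zero) ≡ at c) where
      backward : ∀ j m {x y} → j + m ≡ c → toℕ x ≡ j → toℕ y ≡ suc j → vertex x ≡ at (suc m) × vertex y ≡ at m
      backward zero m refl ex ey = trans (cong vertex (toℕ-injective ex)) e₀ , trans (cong vertex (toℕ-injective ey)) e₁
      backward (suc j) m {x} {y} eq ex ey with w , ew ← below ex with backward j (suc m) (trans (+-suc j m) eq) ew ex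
      ... | w≡ , x≡ with neighbours m (subst (λ v → Adj v (vertex y)) x≡ (edge (trans ey (cong suc (sym ex)))))
      ...   | inj₁ y≡   = x≡ , y≡
      ...   | inj₂ back = contradiction (trans back (sym w≡)) (no-return ew ey)
      backward-at : ∀ t m → t + m ≡ suc c → ∀ x → toℕ x ≡ t → vertex x ≡ at m
      backward-at zero m refl x ex = proj₁ (backward zero c refl ex refl)
      backward-at (suc t) m eq x ex with w , ew ← below ex = proj₂ (backward t m (suc-injective eq) ew ex)
    -- The window that ends at `suc c` starts at `c ∸ k′`; the bound on `c` keeps this subtraction
    -- from being cut off at 0.
    along : ∀ c → k′ ≤ c → at (suc c) ≡ vertex zero → ∃ λ x → vertex x ∈ A
    along c k′≤c e₀ with neighbours c (subst (λ v → Adj v (vertex (suc zero))) (sym e₀) (edge refl))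
    ... | inj₂ e₁ with t , t<k , e ← hits (suc c) = found t<k (forward-at (sym e₀) e₁ t) e
    ... | inj₁ e₁ with t , t<k , e ← hits (c ∸ k′) = found (s≤s (m∸n≤m (suc k′) t))
            (backward-at (sym e₀) e₁ (suc k′ ∸ t) (t + (c ∸ k′)) (begin
              suc k′ ∸ t + (t + (c ∸ k′))  ≡⟨ +-assoc (suc k′ ∸ t) t _ ⟨
              suc k′ ∸ t + t + (c ∸ k′)    ≡⟨ cong (_+ (c ∸ k′)) (m∸n+n≡m (≤-pred t<k)) ⟩
              suc k′ + (c ∸ k′)            ≡⟨ cong suc (m+[n∸m]≡n k′≤c) ⟩
              suc c                        ∎)) e
      where open ≡-Reasoning
    start : (∃ λ i → at i ≡ vertex zero) → ∃ λ x → vertex x ∈ A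
    -- `k` full turns bring the index to at least `k`.
    start (i , eq) = far (k * n + i) (≤-trans (m≤m*n k n) (m≤m+n (k * n) i)) (trans (periodic* k i) eq)
      where
      far : ∀ i → k ≤ i → at i ≡ vertex zero → ∃ λ x → vertex x ∈ A
      far (suc c) k≤ = along c (≤-trans (n≤1+n k′) (≤-pred k≤))

  tokens-window : ∀ A k i → sumTo (token A) (k + i) ≡ sumTo (token A) i + window k A i
  tokens-window A k i = sumTo-+ (token A) i k

  -- Token counts of initial segments, up to an additive constant: moving a token one step ahead
  -- changes the height at a single residue only, where it drops by one.
  record Height (k s : ℕ) (A : Subset n) : Set where
    field
      height : ℕ → ℕ
      step   : ∀ i → height (suc i) ≡ height i + token A i
      turn   : ∀ i → height (n + i) ≡ s + height i
      wide   : ∀ i → height i < height (k + i)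

    step-≤ : ∀ i → height i ≤ height (suc i)
    step-≤ i = ≤-trans (m≤m+n _ _) (≤-reflexive (sym (step i)))

    step-≤-suc : ∀ i → height (suc i) ≤ suc (height i)
    step-≤-suc i with bits (lookup A (at i))
    ... | inj₁ e = ≤-trans (≤-reflexive (trans (step i) (trans (cong (height i +_) e) (+-identityʳ _)))) (n≤1+n _)
    ... | inj₂ e = ≤-reflexive (trans (step i) (trans (cong (height i +_) e) (+-comm _ 1)))

    height-window : ∀ m i → height (m + i) ≡ height i + window m A i
    height-window zero    i = sym (+-identityʳ _)
    height-window (suc m) i = trans (step (m + i)) (trans (cong (_+ token A (m + i)) (height-window m i))
      (+-assoc (height i) _ _))

    Height⇒Hits : Hits k A
    Height⇒Hits i = window⇒hit k A i (+-cancelˡ-< (height i) 0 _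
      (subst₂ _<_ (sym (+-identityʳ _)) (height-window k i) (wide i)))

  -- The offset `c` is the freedom that allows one height function to be placed above another.
  Hits⇒Height : ∀ {k} A c → Hits k A → Height k ∣ A ∣ A
  Hits⇒Height {k} A c hits = record
    { height = λ i → c + sumTo (token A) i
    ; step   = λ i → sym (+-assoc c _ _)
    ; turn   = λ i → trans (cong (c +_) (tokens-turn A i)) (swap-+ c ∣ A ∣ _)
    ; wide   = λ i → +-monoʳ-< c (subst (sumTo (token A) i <_) (sym (tokens-window A k i))
                 (m<m+n _ (hit⇒window k A i (hits i))))
    }

-- Connectivity by slides

module Sliding {n} {G : Graph n} (W : Walk G) where
  open Windows W public

  HitsStep : ℕ → Rule → Subset n → Subset n → Set
  HitsStep k R C D = Hits k C × Step R G C D × Hits k D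

  module Descent {k s A B} (H : Height k s A) (H′ : Height k s B) (s<n : s < n) (n<ks : n < k * s)
    (below : ∀ i → Height.height H′ i ≤ Height.height H i) where
    open Height H
    open Height H′ using () renaming
      (height to g; turn to g-turn; wide to g-wide; step-≤ to g-step-≤; step-≤-suc to g-step-≤-suc)
    open ≤-Reasoning

    0<s : 0 < s
    0<s = n≢0⇒n>0 λ { refl → n≮0 (subst (n <_) (*-zeroʳ k) n<ks) }

    Above : ℕ → Set
    Above i = g i < height i

    -- Compares n h(i) − s i, which is periodic modulo n.
    infix 4 _≼_
    _≼_ : ℕ → ℕ → Set
    i ≼ j = n * height i + s * j ≤ n * height j + s * i

    Above-turn : ∀ {i} → Above i → Above (n + i)
    Above-turn {i} a = subst₂ _<_ (sym (g-turn i)) (sym (turn i)) (+-monoʳ-< s a)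

    Above-unturn : ∀ {i} → Above (n + i) → Above i
    Above-unturn {i} a = +-cancelˡ-< s _ _ (subst₂ _<_ (g-turn i) (turn i) a)

    turn-weight : ∀ i j → n * height (n + i) + s * j ≡ n * s + (n * height i + s * j)
    turn-weight i j = trans (cong (λ x → n * x + s * j) (turn i)) (lemma n s (height i) j)
      where
      lemma : ∀ n s h j → n * (s + h) + s * j ≡ n * s + (n * h + s * j)
      lemma = solve-∀

    turn-index : ∀ i j → n * height i + s * (n + j) ≡ n * s + (n * height i + s * j)
    turn-index i j = lemma n s (height i) j
      where
      lemma : ∀ n s h j → n * h + s * (n + j) ≡ n * s + (n * h + s * j)
      lemma = solve-∀

    record Peak (i : ℕ) : Set where
      field
        above   : Above i
        maximal : ∀ j → Above j → j ≼ i
    open Peak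

    Peak-turn : ∀ {i} → Peak i → Peak (n + i)
    Peak-turn {i} p = record
      { above   = Above-turn (above p)
      ; maximal = λ j a → subst₂ _≤_ (sym (turn-index j i)) (sym (turn-weight i j)) (+-monoʳ-≤ (n * s) (maximal p j a))
      }

    Peak-unturn : ∀ {i} → Peak (n + i) → Peak i
    Peak-unturn {i} p = record
      { above   = Above-unturn (above p)
      ; maximal = λ j a → +-cancelˡ-≤ (n * s) _ _ (subst₂ _≤_ (turn-index j i) (turn-weight i j) (maximal p j a))
      }

    -- For i < n this is n h(i) - s i raised by the constant s n, which keeps it a natural number,
    -- as `argmax` expects.
    φ : ℕ → ℕ
    φ i = n * height i + s * (n ∸ i)

    φ⇒≼ : ∀ {i j} → i < n → j < n → φ i ≤ φ j → i ≼ j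
    φ⇒≼ {i} {j} i<n j<n le = +-cancelʳ-≤ (s * n) _ _ (begin
      n * height i + s * j + s * n          ≡⟨ cong (λ x → n * height i + s * j + s * x) (m∸n+n≡m (<⇒≤ i<n)) ⟨
      n * height i + s * j + s * (n ∸ i + i) ≡⟨ lemma n s (height i) j (n ∸ i) i ⟩
      φ i + (s * i + s * j)                 ≤⟨ +-monoˡ-≤ _ le ⟩
      φ j + (s * i + s * j)                 ≡⟨ cong (φ j +_) (+-comm (s * i) _) ⟩
      φ j + (s * j + s * i)                 ≡⟨ lemma n s (height j) i (n ∸ j) j ⟨
      n * height j + s * i + s * (n ∸ j + j) ≡⟨ cong (λ x → n * height j + s * i + s * x) (m∸n+n≡m (<⇒≤ j<n)) ⟩
      n * height j + s * i + s * n          ∎)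
      where
      lemma : ∀ n s h j d i → n * h + s * j + s * (d + i) ≡ n * h + s * d + (s * i + s * j)
      lemma = solve-∀

    find-peak : (∀ i → height i ≡ g i) ⊎ ∃ λ r → r < n × Peak r
    find-peak with argmax (λ i → g i <? height i) φ n
    ... | inj₁ none = inj₁ (everywhere (λ i → height i ≡ g i)
            (λ {i} eq → trans (turn i) (trans (cong (s +_) eq) (sym (g-turn i))))
            λ r r<n → ≤-antisym (≮⇒≥ (none r r<n)) (below r))
    ... | inj₂ (r , r<n , a , max) = inj₂ (r , r<n , record
            { above   = a
            ; maximal = everywhere (λ j → Above j → j ≼ r)
                (λ {j} IH a → subst₂ _≤_ (sym (turn-weight j r)) (sym (turn-index r j))
                   (+-monoʳ-≤ (n * s) (IH (Above-unturn a))))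
                λ j j<n a → φ⇒≼ j<n r<n (max j j<n a)
            })

    -- Without a token at `i` the height does not change between `i` and `suc i`, so `i` is above as
    -- well and its value is larger by s > 0.
    peak-behind : ∀ {i} → Peak (suc i) → lookup A (at i) ≡ true
    peak-behind {i} p with bits (lookup A (at i))
    ... | inj₂ e = bit≡1 e
    ... | inj₁ e = contradiction (maximal p i (≤-<-trans (g-step-≤ i) (subst (g (suc i) <_) flat (above p)))) (<⇒≱ (begin-strict
            n * height (suc i) + s * i  ≡⟨ cong (λ x → n * x + s * i) flat ⟩
            n * height i + s * i        <⟨ +-monoʳ-< (n * height i) (*-monoʳ-< s {{>-nonZero 0<s}} ≤-refl) ⟩
            n * height i + s * suc i    ∎))
      where
      flat : height (suc i) ≡ height i
      flat = trans (step i) (trans (cong (height i +_) e) (+-identityʳ _))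

    -- A token at `i` would put `suc i` above too, since g rises by at most one, with a value larger
    -- by n - s > 0.
    peak-ahead : ∀ {i} → Peak i → lookup A (at i) ≡ false
    peak-ahead {i} p with bits (lookup A (at i))
    ... | inj₁ e = bit≡0 e
    ... | inj₂ e = contradiction (maximal p (suc i) (≤-<-trans (g-step-≤-suc i) (subst (suc (g i) <_) (sym rise) (s<s (above p)))))
            (<⇒≱ (begin-strict
            n * height i + s * suc i          ≡⟨ cong (n * height i +_) (*-suc s i) ⟩
            n * height i + (s + s * i)        <⟨ +-monoʳ-< (n * height i) (+-monoˡ-< (s * i) s<n) ⟩
            n * height i + (n + s * i)        ≡⟨ lemma n s (height i) i ⟩
            n * suc (height i) + s * i        ≡⟨ cong (λ x → n * x + s * i) rise ⟨
            n * height (suc i) + s * i        ∎))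
      where
      rise : height (suc i) ≡ suc (height i)
      rise = trans (step i) (trans (cong (height i +_) e) (+-comm _ 1))
      lemma : ∀ n s h i → n * h + (n + s * i) ≡ n * suc h + s * i
      lemma = solve-∀

    -- If the window starting at `i` held a single token, then g(i) < g(k + i) < h(i) + 1 would put
    -- `i` above, with a value larger by k s - n > 0.
    peak-slack : ∀ {i} → Peak (k + i) → suc (height i) < height (k + i)
    peak-slack {i} p with m≤n⇒m<n∨m≡n (wide i)
    ... | inj₁ slack = slack
    ... | inj₂ tight = contradiction (maximal p i (≤-pred (≤-<-trans (g-wide i) (subst (g (k + i) <_) (sym tight) (above p)))))
            (<⇒≱ (begin-strict
            n * height (k + i) + s * i        ≡⟨ cong (λ x → n * x + s * i) tight ⟨
            n * suc (height i) + s * i        ≡⟨ lemma n s (height i) i ⟨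
            n * height i + (n + s * i)        <⟨ +-monoʳ-< (n * height i) (+-monoˡ-< (s * i) n<ks) ⟩
            n * height i + (k * s + s * i)    ≡⟨ lemma′ n s (height i) k i ⟩
            n * height i + s * (k + i)        ∎))
      where
      lemma : ∀ n s h i → n * h + (n + s * i) ≡ n * suc h + s * i
      lemma = solve-∀
      lemma′ : ∀ n s h k i → n * h + (k * s + s * i) ≡ n * h + s * (k + i)
      lemma′ = solve-∀

    module Lower {p} (peak : Peak (suc p)) where
      x = at p
      y = at (suc p)

      A′ : Subset n
      A′ = slide A x y

      x∈A : lookup A x ≡ true
      x∈A = peak-behind peak

      y∉A : lookup A y ≡ false
      y∉A = peak-ahead peak

      Peak-y : ∀ {i} → at i ≡ y → Peak i
      Peak-y eq = respects Peak Peak-turn Peak-unturn (sym eq) peak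

      -- All indices naming `y` are peaks, hence have positive height, so `pred` really subtracts
      -- one there.
      height′ : ℕ → ℕ
      height′ i with at i Fin.≟ y
      ... | yes _ = pred (height i)
      ... | no  _ = height i

      lowered : ∀ {i} → at i ≡ y → suc (height′ i) ≡ height i
      lowered {i} eq with at i Fin.≟ y
      ... | yes _ = suc-pred (height i) {{>-nonZero (≤-<-trans z≤n (above (Peak-y eq)))}}
      ... | no ne = contradiction eq ne

      kept : ∀ {i} → at i ≢ y → height′ i ≡ height i
      kept {i} ne with at i Fin.≟ y
      ... | yes eq = contradiction eq ne
      ... | no _   = refl

      height′-≤ : ∀ i → height′ i ≤ height i
      height′-≤ i with at i Fin.≟ y
      ... | yes _ = pred[n]≤n
      ... | no  _ = ≤-refl

      token-x : ∀ {i} → at i ≡ x → token A i ≡ 1 × token A′ i ≡ 0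
      token-x eq = cong bit (trans (cong (lookup A) eq) x∈A) ,
                   cong bit (trans (cong (lookup A′) eq) (lookup-slide-source A x∈A y∉A))

      token-y : ∀ {i} → at i ≡ y → token A i ≡ 0 × token A′ i ≡ 1
      token-y eq = cong bit (trans (cong (lookup A) eq) y∉A) ,
                   cong bit (trans (cong (lookup A′) eq) (lookup-slide-target A x∈A y∉A))

      step′ : ∀ i → height′ (suc i) ≡ height′ i + token A′ i
      step′ i with at (suc i) Fin.≟ y | at i Fin.≟ y
      ... | yes eq | yes eq′ = contradiction (trans eq (sym eq′)) (apart {i} (s≤s z≤n) (≤-trans (s≤s (s≤s z≤n)) large))
      ... | yes eq | no ne = begin-equality
              pred (height (suc i))      ≡⟨ cong pred (trans (step i) (cong (height i +_) (proj₁ (token-x ix)))) ⟩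
              pred (height i + 1)        ≡⟨ cong pred (+-comm (height i) 1) ⟩
              height i                   ≡⟨ +-identityʳ (height i) ⟨
              height i + 0               ≡⟨ cong (height i +_) (proj₂ (token-x ix)) ⟨
              height i + token A′ i      ∎
        where
        ix : at i ≡ x
        ix = unshift 1 eq
      ... | no ne | yes eq = begin-equality
              height (suc i)                    ≡⟨ trans (step i) (cong (height i +_) (proj₁ (token-y eq))) ⟩
              height i + 0                      ≡⟨ +-identityʳ (height i) ⟩
              height i                          ≡⟨ suc-pred (height i) {{>-nonZero (≤-<-trans z≤n (above (Peak-y eq)))}} ⟨
              1 + pred (height i)               ≡⟨ +-comm 1 _ ⟩
              pred (height i) + 1               ≡⟨ cong (pred (height i) +_) (proj₂ (token-y eq)) ⟨
              pred (height i) + token A′ i      ∎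
      ... | no ne | no ne′ = trans (step i) (cong (λ b → height i + bit b)
              (sym (lookup-slide-other A x∈A y∉A (λ eq → ne (shift 1 eq)) ne′)))

      turn′ : ∀ i → height′ (n + i) ≡ s + height′ i
      turn′ i = case at i Fin.≟ y of λ where
        (no ne)  → trans (kept (ne ∘ trans (sym (periodic i)))) (trans (turn i) (cong (s +_) (sym (kept ne))))
        (yes eq) → suc-injective (trans (lowered (trans (periodic i) eq)) (trans (turn i)
                     (trans (cong (s +_) (sym (lowered eq))) (+-suc s _))))

      -- Lowering the left end of a window does no harm; a lowered right end is covered by
      -- `peak-slack`.
      wide′ : ∀ i → height′ i < height′ (k + i)
      wide′ i = case at (k + i) Fin.≟ y of λ where
        (yes eq) → ≤-<-trans (height′-≤ i) (≤-pred (subst (suc (height i) <_) (sym (lowered eq)) (peak-slack (Peak-y eq))))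
        (no ne)  → ≤-<-trans (height′-≤ i) (subst (height i <_) (sym (kept ne)) (wide i))

      lower : Height k s A′
      lower = record { height = height′ ; step = step′ ; turn = turn′ ; wide = wide′ }

      still-below : ∀ i → g i ≤ height′ i
      still-below i = case at i Fin.≟ y of λ where
        (yes eq) → ≤-pred (subst (g i <_) (sym (lowered eq)) (above (Peak-y eq)))
        (no ne)  → subst (g i ≤_) (sym (kept ne)) (below i)

      smaller : ∀ {r} → r < n → at r ≡ y → sumTo height′ n < sumTo height n
      smaller r<n eq = sumTo-monoʳ-< n height′-≤ r<n (≤-reflexive (lowered eq))

      step-TS : Step TS G A A′
      step-TS = x , y , lost-by-slide A x∈A y∉A , gained-by-slide A x∈A y∉A , adjacent p

  heights-agree : ∀ {k s A B} (H : Height k s A) (H′ : Height k s B) →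
    (∀ i → Height.height H i ≡ Height.height H′ i) → A ≡ B
  heights-agree {A = A} {B} H H′ eq = lookup-ext λ v →
    subst (λ v → lookup A v ≡ lookup B v) (proj₂ (onto v)) (at-index (proj₁ (onto v)))
    where
    at-index : ∀ i → lookup A (at i) ≡ lookup B (at i)
    at-index i = bit-injective (+-cancelˡ-≡ (Height.height H i) _ _ (trans (sym (Height.step H i))
      (trans (eq (suc i)) (trans (Height.step H′ i) (cong (_+ token B i) (sym (eq i)))))))

  -- `N` is fuel: each slide lowers the sum of the heights over one turn.
  descend : ∀ {k s A B} N (H : Height k s A) (H′ : Height k s B) → s < n → n < k * s →
    (∀ i → Height.height H′ i ≤ Height.height H i) → sumTo (Height.height H) n < N →
    Star (HitsStep k TS) A B
  descend (suc N) H H′ s<n n<ks below enough with Descent.find-peak H H′ s<n n<ks below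
  ... | inj₁ eq = subst (Star _ _) (heights-agree H H′ eq) ε
  ... | inj₂ (r , r<n , peak) = (Height.Height⇒Hits H , step-TS , Height.Height⇒Hits lower) ◅
        descend N lower H′ s<n n<ks still-below (<-≤-trans (smaller r<n (sym (trans (cong at r′) (periodic r)))) (≤-pred enough))
    where
    -- The peak found may be index 0; one turn later it has a predecessor, where the token to be
    -- moved sits.
    r′ : suc (pred n + r) ≡ n + r
    r′ = cong (_+ r) (suc-pred n)
    open Descent H H′ s<n n<ks below
    open Lower {pred n + r} (subst Peak (sym r′) (Peak-turn peak))

  connected : ∀ {k} A B → Hits k A → Hits k B → ∣ A ∣ ≡ ∣ B ∣ → n < k * ∣ A ∣ → Star (HitsStep k TS) A B
  connected {k} A B hitsA hitsB eq n<ks with m≤n⇒m<n∨m≡n (∣p∣≤n A)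
  ... | inj₂ ∣A∣≡n = subst (Star _ A) (trans (∣p∣≡n⇒p≡⊤ ∣A∣≡n) (sym (∣p∣≡n⇒p≡⊤ (trans (sym eq) ∣A∣≡n)))) ε
  -- On the first turn the counts of `B` never exceed |B| = |A|, so the offset |A| puts `A` above
  -- `B` there, and periodicity extends this to all indices.
  ... | inj₁ ∣A∣<n = descend _ (Hits⇒Height A ∣ A ∣ hitsA) (subst (λ s → Height k s B) (sym eq) (Hits⇒Height B 0 hitsB))
        ∣A∣<n n<ks (λ i → subst (_≤ ∣ A ∣ + sumTo (token A) i) (sym (heightB eq i)) (lagging i)) ≤-refl
    where
    heightB : ∀ {s} (e : s ≡ ∣ B ∣) i →
      Height.height (subst (λ s → Height k s B) (sym e) (Hits⇒Height B 0 hitsB)) i ≡ sumTo (token B) i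
    heightB refl i = refl
    lagging : ∀ i → sumTo (token B) i ≤ ∣ A ∣ + sumTo (token A) i
    lagging = everywhere (λ i → sumTo (token B) i ≤ ∣ A ∣ + sumTo (token A) i)
      (λ {i} IH → subst₂ _≤_ (sym (trans (tokens-turn B i) (cong (_+ sumTo (token B) i) (sym eq))))
        (cong (∣ A ∣ +_) (sym (tokens-turn A i))) (+-monoʳ-≤ ∣ A ∣ IH))
      λ r r<n → ≤-trans (sumTo-mono-≤ (token B) (<⇒≤ r<n)) (≤-trans (≤-reflexive (trans (tokens-per-turn B) (sym eq))) (m≤m+n _ _))

-- Reachability under the three rules

∣∪∣ : ∀ {n} (A B : Subset n) → ∣ A ∪ B ∣ ≡ ∣ A ∣ + ∣ B ─ A ∣
∣∪∣ []          []          = refl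
∣∪∣ (true  ∷ A) (true  ∷ B) = cong suc (∣∪∣ A B)
∣∪∣ (true  ∷ A) (false ∷ B) = cong suc (∣∪∣ A B)
∣∪∣ (false ∷ A) (true  ∷ B) = trans (cong suc (∣∪∣ A B)) (sym (+-suc _ _))
∣∪∣ (false ∷ A) (false ∷ B) = ∣∪∣ A B

∣∣≡0⇒≡ : ∀ {n} (A B : Subset n) → ∣ A ∣ ≡ 0 → ∣ B ∣ ≡ 0 → A ≡ B
∣∣≡0⇒≡ []          []          _ _ = refl
∣∣≡0⇒≡ (false ∷ A) (false ∷ B) a b = cong (false ∷_) (∣∣≡0⇒≡ A B a b)

cover-⊆ : ∀ {k n} {G : Graph n} {A B} → A ⊆ B → IsPathVertexCover k G A → IsPathVertexCover k G B
cover-⊆ A⊆B cover p with i , i∈A ← cover p = i , A⊆B i∈A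

Step-∣∣ : ∀ {n} {G : Graph n} {C D} → Step TJ G C D → ∣ C ∣ ≡ ∣ D ∣
Step-∣∣ {C = C} {D} (x , y , lost , gained) = +-cancelʳ-≡ 1 _ _ (begin
  ∣ C ∣ + 1            ≡⟨ cong (∣ C ∣ +_) (trans (cong ∣_∣ gained) (∣⁅x⁆∣≡1 y)) ⟨
  ∣ C ∣ + ∣ D ─ C ∣    ≡⟨ ∣exchange∣ C D ⟩
  ∣ D ∣ + ∣ C ─ D ∣    ≡⟨ cong (∣ D ∣ +_) (trans (cong ∣_∣ lost) (∣⁅x⁆∣≡1 x)) ⟩
  ∣ D ∣ + 1            ∎)
  where open ≡-Reasoning

TS⇒TJ : ∀ {n} {G : Graph n} {C D} → Step TS G C D → Step TJ G C D
TS⇒TJ (x , y , lost , gained , _) = x , y , lost , gained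

module Reconfiguration (k : ℕ) (R : Rule) (u : Parameter R) {n} (G : Graph n) where

  Valid : Subset n → Set
  Valid C = IsPathVertexCover k G C × Bounded R u C

  Move : Subset n → Subset n → Set
  Move C D = Valid C × Step R G C D × Valid D

  fromStar : ∀ {I J} → Valid I → Star Move I J → ReconfigurationSequence k R u G I J
  fromStar {I} (c , b) ε = record
    { ℓ = 0 ; term = λ _ → I ; start = refl ; end = refl ; cover = λ _ → c ; bounded = λ _ → b ; step = λ () }
  fromStar {I} (c , b) ((_ , s , v) ◅ rest) = record
    { ℓ       = suc ℓ
    ; term    = λ { zero → I ; (suc i) → term i }
    ; start   = refl
    ; end     = end
    ; cover   = λ { zero → c ; (suc i) → cover i }
    ; bounded = λ { zero → b ; (suc i) → bounded i }
    ; step    = λ { zero → subst (Step R G I) (sym start) s ; (suc i) → step i }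
    }
    where open ReconfigurationSequence (fromStar v rest)

  toStar : ∀ {I J} → ReconfigurationSequence k R u G I J → Star Move I J
  toStar seq = subst₂ (Star Move) start end (go ℓ term (λ i → cover i , bounded i) step)
    where
    open ReconfigurationSequence seq
    go : ∀ ℓ (term : Fin (suc ℓ) → Subset n) → (∀ i → Valid (term i)) →
      (∀ (i : Fin ℓ) → Step R G (term (inject₁ i)) (term (suc i))) → Star Move (term zero) (term (fromℕ ℓ))
    go zero    term valid step = ε
    go (suc ℓ) term valid step = (valid zero , step zero , valid (suc zero)) ◅ go ℓ (term ∘ suc) (valid ∘ suc) (step ∘ suc)

  valid-start : ∀ {I J} → ReconfigurationSequence k R u G I J → Valid I
  valid-start seq = subst Valid start (cover zero , bounded zero)
    where open ReconfigurationSequence seq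

  valid-end : ∀ {I J} → ReconfigurationSequence k R u G I J → Valid J
  valid-end seq = subst Valid end (cover (fromℕ ℓ) , bounded (fromℕ ℓ))
    where open ReconfigurationSequence seq

module Covers {n} {G : Graph n} (W : Walk G) {k : ℕ} (2≤k : 2 ≤ k) where
  open Sliding W public

  private
    Cover : Subset n → Set
    Cover = IsPathVertexCover k G

  all-cover : n < k → ∀ A → Cover A
  all-cover n<k A p = contradiction (Fin.injective⇒≤ (Path.injective p)) (<⇒≱ n<k)

  height-steps : ∀ {s A} (H : Height k s A) → let open Height H in ∀ m i → m + height i ≤ height (m * k + i)
  height-steps H zero    i = ≤-refl
  height-steps H (suc m) i = ≤-trans (s≤s (height-steps H m i))
    (subst (λ x → suc (Height.height H (m * k + i)) ≤ Height.height H x) (sym (+-assoc k (m * k) i)) (Height.wide H _))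

  height-turns : ∀ {s A} (H : Height k s A) → let open Height H in ∀ m i → height (m * n + i) ≡ m * s + height i
  height-turns H zero i = refl
  height-turns {s} H (suc m) i = trans (cong (Height.height H) (+-assoc n (m * n) i)) (trans (Height.turn H _)
    (trans (cong (s +_) (height-turns H m i)) (sym (+-assoc s (m * s) _))))

  -- Double counting over n k consecutive indices: they form n windows of length k, each with at
  -- least one token, and also k full turns with |A| tokens each.
  Hits⇒size : ∀ A → Hits k A → n ≤ k * ∣ A ∣
  Hits⇒size A hits = +-cancelʳ-≤ (height 0) _ _ (begin
    n + height 0            ≤⟨ height-steps H n 0 ⟩
    height (n * k + 0)      ≡⟨ cong (λ x → height (x + 0)) (*-comm n k) ⟩
    height (k * n + 0)      ≡⟨ height-turns H k 0 ⟩
    k * ∣ A ∣ + height 0    ∎)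
    where
    open ≤-Reasoning
    H = Hits⇒Height {k} A 0 hits
    open Height H

  -- With k |A| = n no window can hold two tokens, which makes A invariant under a shift by k.
  tight : ∀ A → Hits k A → k * ∣ A ∣ ≡ n → ∀ i → lookup A (at (k + i)) ≡ lookup A (at i)
  tight A hits eq i = bit-injective (+-cancelˡ-≡ (height (k + i)) _ _ (begin
    height (k + i) + token A (k + i)     ≡⟨ step (k + i) ⟨
    height (suc (k + i))                 ≡⟨ cong height (+-suc k i) ⟨
    height (k + suc i)                   ≡⟨ exact (suc i) ⟩
    suc (height (suc i))                 ≡⟨ cong suc (step i) ⟩
    suc (height i) + token A i           ≡⟨ cong (_+ token A i) (exact i) ⟨
    height (k + i) + token A i           ∎))
    where
    open Height (Hits⇒Height {k} A 0 hits)
    open ≡-Reasoning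
    s≢0 : NonZero ∣ A ∣
    s≢0 = ≢-nonZero λ s≡0 → contradiction (trans (sym eq) (trans (cong (k *_) s≡0) (*-zeroʳ k)))
      (>⇒≢ (≤-trans (s≤s z≤n) large))
    s≡ : suc (pred ∣ A ∣) ≡ ∣ A ∣
    s≡ = suc-pred ∣ A ∣ {{s≢0}}
    around : ∀ i → pred ∣ A ∣ * k + (k + i) ≡ n + i
    around i = trans (lemma (pred ∣ A ∣) k i) (cong (_+ i) (trans (cong (k *_) s≡) eq))
      where
      lemma : ∀ p k i → p * k + (k + i) ≡ k * suc p + i
      lemma = solve-∀
    -- The remaining |A| - 1 windows of the turn take at least |A| - 1 of its |A| tokens, which
    -- leaves at most one for the window at `i`.
    exact : ∀ i → height (k + i) ≡ suc (height i)
    exact i = ≤-antisym (+-cancelˡ-≤ (pred ∣ A ∣) _ _ (≤-trans (height-steps (Hits⇒Height {k} A 0 hits) (pred ∣ A ∣) (k + i))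
      (≤-reflexive (trans (cong height (around i)) (trans (turn i)
        (trans (cong (_+ height i) (sym s≡)) (sym (+-suc _ _)))))))) (wide i)

  Crowded : Subset n → ℕ → Set
  Crowded A i = 2 < window (suc k) A i

  Removable : Subset n → Set
  Removable A = ∃ λ x → lookup A x ≡ true × Cover (A [ x ]≔ false)

  -- The middle token, at `t₂`, is dispensable: a window that meets it at position `t` reaches back
  -- to `t₁` if t ≥ t₂ - t₁, and otherwise forward to `t₃`, because t₃ - t₁ ≤ k.
  crowded⇒removable : ∀ A {i} → k ≤ n → Hits k A → Crowded A i → Removable A
  crowded⇒removable A {i} k≤n hits crowded
    with t₃ , t₃≤k , e₃ , c₃ , _ ← sumTo-last (λ t → token A (t + i)) (λ _ → bits _) 2 (suc k) crowded
    with t₂ , t₂<t₃ , e₂ , c₂ , _ ← sumTo-last (λ t → token A (t + i)) (λ _ → bits _) 1 t₃ c₃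
    with t₁ , t₁<t₂ , e₁ , _ ← sumTo-last (λ t → token A (t + i)) (λ _ → bits _) 0 t₂ c₂
    = at (t₂ + i) , bit≡1 e₂ , Hits⇒cover A′ 2≤k hits′
    where
    A′ = A [ at (t₂ + i) ]≔ false
    remains : ∀ {v} → v ≢ at (t₂ + i) → lookup A v ≡ true → lookup A′ v ≡ true
    remains v≢ v∈A = trans (lookup∘update′ v≢ A false) v∈A
    gap : ∀ {a b} → a < b → b ∸ a + (a + i) ≡ b + i
    gap {a} {b} a<b = trans (sym (+-assoc (b ∸ a) a i)) (cong (_+ i) (m∸n+n≡m (<⇒≤ a<b)))
    left≢ : at (t₁ + i) ≢ at (t₂ + i)
    left≢ eq = apart (m<n⇒0<n∸m t₁<t₂) (≤-<-trans (m∸n≤m t₂ t₁) (<-≤-trans t₂<t₃ (≤-trans (≤-pred t₃≤k) k≤n)))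
      (trans (cong at (gap t₁<t₂)) (sym eq))
    right≢ : at (t₃ + i) ≢ at (t₂ + i)
    right≢ eq = apart (m<n⇒0<n∸m t₂<t₃) (<-≤-trans (∸-monoʳ-< {t₃} (≤-<-trans z≤n t₁<t₂) (<⇒≤ t₂<t₃)) (≤-trans (≤-pred t₃≤k) k≤n))
      (trans (cong at (gap t₂<t₃)) eq)
    hits′ : Hits k A′
    hits′ i′ with t , t<k , e ← hits i′ | at (t + i′) Fin.≟ at (t₂ + i)
    ... | no ne  = t , t<k , remains ne e
    ... | yes eq with t₂ ∸ t₁ ≤? t
    ...   | yes le = t ∸ (t₂ ∸ t₁) , ≤-<-trans (m∸n≤m t (t₂ ∸ t₁)) t<k ,
              subst (λ v → lookup A′ v ≡ true) (sym left) (remains left≢ (bit≡1 e₁))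
      where
      left : at (t ∸ (t₂ ∸ t₁) + i′) ≡ at (t₁ + i)
      left = unshift (t₂ ∸ t₁) (trans (cong at (trans (sym (+-assoc (t₂ ∸ t₁) _ i′)) (cong (_+ i′) (m+[n∸m]≡n le))))
        (trans eq (cong at (sym (gap t₁<t₂)))))
    ...   | no nle = t₃ ∸ t₂ + t , <-≤-trans (+-monoʳ-< (t₃ ∸ t₂) (≰⇒> nle)) span ,
              subst (λ v → lookup A′ v ≡ true) (sym right) (remains right≢ (bit≡1 e₃))
      where
      span : t₃ ∸ t₂ + (t₂ ∸ t₁) ≤ k
      span = ≤-trans (+-monoʳ-≤ (t₃ ∸ t₂) (m∸n≤m t₂ t₁)) (≤-trans (≤-reflexive (m∸n+n≡m (<⇒≤ t₂<t₃))) (≤-pred t₃≤k))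
      right : at (t₃ ∸ t₂ + t + i′) ≡ at (t₃ + i)
      right = trans (cong at (+-assoc (t₃ ∸ t₂) t i′)) (trans (shift (t₃ ∸ t₂) eq) (cong at (gap t₂<t₃)))

  -- Take the last remaining token in the k places before `x`, then a remaining token in the k
  -- places after that one. The latter lies beyond `x`, so these two and `x` are three tokens among
  -- k + 1 consecutive indices.
  removable⇒crowded : ∀ A → k ≤ n → Removable A → ∃ (Crowded A)
  removable⇒crowded A k≤n (x , x∈A , cover)
    with t , t<k , e , _ , later ← sumTo-last (λ t → token (A [ x ]≔ false) (t + (k * pred n + proj₁ (onto x))))
           (λ _ → bits _) 0 k (hit⇒window k (A [ x ]≔ false) _ (cover⇒Hits (A [ x ]≔ false) k≤n cover _))
    with t′ , t′<k , e′ ← cover⇒Hits (A [ x ]≔ false) k≤n cover (suc (t + (k * pred n + proj₁ (onto x))))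
    = t + i₀ , ≤-trans (s≤s (≤-trans (s≤s (≤-<-trans z≤n first)) second)) third
    where
    -- An index of `x` moved back by `k` modulo n, so that the window of length k at `i₀` ends just
    -- before `x`.
    i₀ = k * pred n + proj₁ (onto x)
    A′ = A [ x ]≔ false
    x≡ : at (k + i₀) ≡ x
    x≡ = trans (cong at (+-comm k i₀)) (trans (complement k _) (proj₂ (onto x)))
    old : ∀ v → lookup A′ v ≡ true → lookup A v ≡ true
    old v v∈A′ with v Fin.≟ x
    ... | yes refl = x∈A
    ... | no ne    = trans (sym (lookup∘update′ ne A false)) v∈A′
    rearrange : t′ + suc (t + i₀) ≡ t′ + suc t + i₀
    rearrange = sym (+-assoc t′ (suc t) i₀)
    beyond : k < t′ + suc t
    beyond = ≤∧≢⇒< (≮⇒≥ λ lt → contradiction (trans (sym (later (t′ + suc t) (m≤n+m _ t′) lt)) (trans (cong (token A′) (sym rearrange)) (cong bit e′))) λ ())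
      λ eq → contradiction (trans (sym e′) (trans (cong (lookup A′) (trans (cong at (trans rearrange (cong (_+ i₀) (sym eq)))) x≡)) (lookup∘update x A false))) λ ()
    f = λ j → token A (j + (t + i₀))
    first : sumTo f 0 < sumTo f (k ∸ t)
    first = sumTo-hit f (m<n⇒0<n∸m t<k) (cong bit (old _ (bit≡1 e)))
    second : sumTo f (k ∸ t) < sumTo f (suc t′)
    second = sumTo-hit f (+-cancelʳ-< t _ _ (subst₂ _<_ (sym (m∸n+n≡m (<⇒≤ t<k))) (+-suc t′ t) beyond))
      (cong bit (trans (cong (lookup A) (trans (cong at (trans (sym (+-assoc (k ∸ t) t i₀)) (cong (_+ i₀) (m∸n+n≡m (<⇒≤ t<k))))) x≡)) x∈A))
    third : sumTo f (suc t′) < sumTo f (suc k)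
    third = sumTo-hit f (s≤s t′<k) (cong bit (trans (cong (λ j → lookup A (at j)) (sym (+-suc t′ (t + i₀)))) (old _ e′)))

  nonempty⇒Hits : ∀ A → 0 < ∣ A ∣ → Hits n A
  nonempty⇒Hits A pos i = window⇒hit n A i (+-cancelˡ-< (sumTo (token A) i) 0 _
    (subst₂ _<_ (sym (+-identityʳ _)) (trans (+-comm (sumTo (token A) i) ∣ A ∣)
      (trans (sym (tokens-turn A i)) (tokens-window A n i))) (m<m+n _ pos)))

  Hits-suc-n : ∀ A → Hits (suc n) A → Hits n A
  Hits-suc-n A hits i with t , t≤n , e ← hits i with m≤n⇒m<n∨m≡n (≤-pred t≤n)
  ... | inj₁ t<n  = t , t<n , e
  ... | inj₂ refl = 0 , >-nonZero⁻¹ n , trans (cong (lookup A) (sym (periodic i))) e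

  CoverStep : Rule → Subset n → Subset n → Set
  CoverStep R C D = Cover C × Step R G C D × Cover D

  -- For n ≤ k the window length becomes `suc n`: a nonempty set meets every such window, and n < (n
  -- + 1) s holds for every s > 0. In the other direction a set met by these windows is nonempty,
  -- which suffices to cover when n = k; when n < k there are no k-paths at all.
  slides : ∀ {A B} → Cover A → Cover B → ∣ A ∣ ≡ ∣ B ∣ → n < k * ∣ A ∣ ⊎ n ≤ k → Star (CoverStep TS) A B
  slides {A} {B} coverA coverB eq room with n ≤? k
  ... | no n≰k = mapStar (λ {C} {D} (c , s , d) → Hits⇒cover C 2≤k c , s , Hits⇒cover D 2≤k d)
        (connected A B (cover⇒Hits A k≤n coverA) (cover⇒Hits B k≤n coverB) eq ([ id , (λ n≤k → contradiction n≤k n≰k) ]′ room))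
    where k≤n = <⇒≤ (≰⇒> n≰k)
  ... | yes n≤k with ∣ A ∣ in size
  ...   | zero  = subst (Star _ A) (∣∣≡0⇒≡ A B size (sym eq)) ε
  ...   | suc s = mapStar (λ {C} {D} (c , s , d) → covers C c , s , covers D d)
          (connected {suc n} A B (wider A (subst (0 <_) (sym size) (s≤s z≤n))) (wider B (subst (0 <_) eq (s≤s z≤n))) (trans size eq)
            (subst (λ x → n < suc n * x) (sym size) (m≤m*n (suc n) (suc s))))
    where
    wider : ∀ C → 0 < ∣ C ∣ → Hits (suc n) C
    wider C pos i with t , t<n , e ← nonempty⇒Hits C pos i = t , m<n⇒m<1+n t<n , e
    covers : ∀ C → Hits (suc n) C → Cover C
    covers C hits with m≤n⇒m<n∨m≡n n≤k
    ... | inj₁ n<k  = all-cover n<k C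
    ... | inj₂ refl = Hits⇒cover C 2≤k (Hits-suc-n C hits)

  ∣∣-invariant : ∀ {A B} → Star (CoverStep TJ) A B → ∣ A ∣ ≡ ∣ B ∣
  ∣∣-invariant ε = refl
  ∣∣-invariant ((_ , s , _) ◅ rest) = trans (Step-∣∣ {G = G} s) (∣∣-invariant rest)

  0<k : 0 < k
  0<k = ≤-trans (s≤s z≤n) 2≤k

  -- Suppose a first jump took the token `x`. By periodicity of `A` there is a token k places
  -- further on, at another vertex since k < n; it stays in `C`, and periodicity of `C` then puts
  -- `x` back.
  tight-stuck : ∀ {A B} → k < n → k * ∣ A ∣ ≤ n → Star (CoverStep TJ) A B → A ≡ B
  tight-stuck k<n small ε = refl
  tight-stuck {A} k<n small (_◅_ {j = C} (coverA , s@(x , _ , lost , _) , coverC) _) =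
    contradiction (trans (sym keeps-x) x∉C) λ ()
    where
    hitsA = cover⇒Hits A (<⇒≤ k<n) coverA
    hitsC = cover⇒Hits C (<⇒≤ k<n) coverC
    eqA : k * ∣ A ∣ ≡ n
    eqA = ≤-antisym small (Hits⇒size A hitsA)
    eqC : k * ∣ C ∣ ≡ n
    eqC = trans (cong (k *_) (sym (Step-∣∣ {G = G} s))) eqA
    x∈─ : lookup (A ─ C) x ≡ true
    x∈─ = trans (cong (λ S → lookup S x) lost) ([]=⇒lookup (x∈⁅x⁆ x))
    x∈A : lookup A x ≡ true
    x∈A with lookup A x in eq
    ... | true  = refl
    ... | false = trans (sym (lookup-─-∉ A C x eq)) x∈─
    x∉C : lookup C x ≡ false
    x∉C with lookup C x in eq
    ... | false = refl
    ... | true  = trans (sym x∈─) (lookup-─-same A C x (trans x∈A (sym eq)))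
    i = proj₁ (onto x)
    keeps-next : lookup C (at (k + i)) ≡ true
    keeps-next with lookup C (at (k + i)) in eq
    ... | true  = refl
    ... | false = contradiction (trans (x∈⁅y⁆⇒x≡y x (lookup⇒[]= (at (k + i)) ⁅ x ⁆
            (trans (cong (λ S → lookup S (at (k + i))) (sym lost))
              (lookup-─ A C (at (k + i)) (trans (tight A hitsA eqA i) (trans (cong (lookup A) (proj₂ (onto x))) x∈A)) eq))))
            (sym (proj₂ (onto x)))) (apart 0<k k<n)
    keeps-x : lookup C x ≡ true
    keeps-x = trans (cong (lookup C) (sym (proj₂ (onto x)))) (trans (sym (tight C hitsC eqC i)) keeps-next)

  -- Adding and removing tokens under a size bound

  module Addition (u : Parameter TAR) where
    open Reconfiguration k TAR u G public

    bound = proj₁ u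

    Star-sym : ∀ {A B} → Star Move A B → Star Move B A
    Star-sym = reverse λ { {C} {D} (c , s , d) → d , Flip-sym {A = C} {D} s , c }

    climb : ∀ {A B} → A ⊆ B → Cover A → ∣ B ∣ ≤ bound → Star Move A B
    climb {A} {B} A⊆B cover ∣B∣≤u = mapStar
      (λ ((l , r) , f , (l′ , r′)) → valid l r , f , valid l′ r′) (fill A B A⊆B)
      where
      valid : ∀ {C} → A ⊆ C → C ⊆ B → Valid C
      valid l r = cover-⊆ {G = G} l cover , ≤-trans (p⊆q⇒∣p∣≤∣q∣ r) ∣B∣≤u

    via-∩ : ∀ {A B} → Cover (A ∩ B) → ∣ A ∣ ≤ bound → ∣ B ∣ ≤ bound → Star Move A B
    via-∩ {A} {B} cover ∣A∣≤u ∣B∣≤u =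
      Star-sym (climb (p∩q⊆p A B) cover ∣A∣≤u) ◅◅ climb (p∩q⊆q A B) cover ∣B∣≤u

    -- The slide passes through the union, which has one token more than `A`.
    via-∪ : ∀ {A B} → CoverStep TS A B → ∣ A ∣ < bound → Star Move A B
    via-∪ {A} {B} (coverA , (_ , y , _ , gained , _) , coverB) ∣A∣<u =
      climb (p⊆p∪q B) coverA size ◅◅ Star-sym (climb (q⊆p∪q A B) coverB size)
      where
      size : ∣ A ∪ B ∣ ≤ bound
      size = ≤-trans (≤-reflexive (trans (∣∪∣ A B)
        (trans (cong (∣ A ∣ +_) (trans (cong ∣_∣ gained) (∣⁅x⁆∣≡1 y))) (+-comm _ 1)))) ∣A∣<u

    via-slides : ∀ {A B} → Star (CoverStep TS) A B → ∣ A ∣ < bound → Star Move A B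
    via-slides ε _ = ε
    via-slides (s@(_ , move , _) ◅ rest) ∣A∣<u =
      via-∪ s ∣A∣<u ◅◅ via-slides rest (subst (_< bound) (Step-∣∣ {G = G} (TS⇒TJ {G = G} move)) ∣A∣<u)

    Reducible : Subset n → Set
    Reducible A = ∣ A ∣ < bound ⊎ Removable A

    reduce : ∀ {A} → Cover A → ∣ A ∣ ≤ bound → Reducible A →
      ∃ λ A′ → A′ ⊆ A × Cover A′ × ∣ A′ ∣ < bound
    reduce {A} cover ∣A∣≤u (inj₁ ∣A∣<u) = A , id , cover , ∣A∣<u
    reduce {A} cover ∣A∣≤u (inj₂ (x , x∈A , cover′)) = A [ x ]≔ false ,
      lookup-⊆ (λ v v∈ → case v Fin.≟ x of λ where
        (yes refl) → x∈A
        (no v≢x)   → trans (sym (lookup∘update′ v≢x A false)) v∈) ,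
      cover′ , subst (_≤ bound) (sym (∣remove∣ A x x∈A)) ∣A∣≤u

    -- Both covers shrink below the bound and are then filled up to the largest size that fits the
    -- graph and leaves space for one more token. At this common size they are joined by slides.
    room⇒reachable : ∀ {A B} → Cover A → Cover B → ∣ A ∣ ≤ bound → ∣ B ∣ ≤ bound → Reducible A → Reducible B →
      n ≤ k ⊎ n < k * (n ⊓ pred bound) → Star Move A B
    room⇒reachable {A} {B} coverA coverB ∣A∣≤u ∣B∣≤u redA redB room
      with A⁻ , A⁻⊆A , coverA⁻ , ∣A⁻∣<u ← reduce coverA ∣A∣≤u redA
      with B⁻ , B⁻⊆B , coverB⁻ , ∣B⁻∣<u ← reduce coverB ∣B∣≤u redB
      with A⁺ , A⁻⊆A⁺ , eqA ← grow A⁻ (n ⊓ pred bound) (⊓-glb (∣p∣≤n A⁻) (<⇒≤pred ∣A⁻∣<u)) (m⊓n≤m n _)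
      with B⁺ , B⁻⊆B⁺ , eqB ← grow B⁻ (n ⊓ pred bound) (⊓-glb (∣p∣≤n B⁻) (<⇒≤pred ∣B⁻∣<u)) (m⊓n≤m n _)
      = Star-sym (climb A⁻⊆A coverA⁻ ∣A∣≤u)
        ◅◅ climb A⁻⊆A⁺ coverA⁻ (<⇒≤ ∣A⁺∣<u)
        ◅◅ via-slides (slides (cover-⊆ {G = G} A⁻⊆A⁺ coverA⁻) (cover-⊆ {G = G} B⁻⊆B⁺ coverB⁻) (trans eqA (sym eqB))
             ([ inj₂ , (λ lt → inj₁ (subst (λ s → n < k * s) (sym eqA) lt)) ]′ room)) ∣A⁺∣<u
        ◅◅ Star-sym (climb B⁻⊆B⁺ coverB⁻ (subst (_≤ bound) (trans eqA (sym eqB)) (<⇒≤ ∣A⁺∣<u)))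
        ◅◅ climb B⁻⊆B coverB⁻ ∣B∣≤u
      where
      ∣A⁺∣<u : ∣ A⁺ ∣ < bound
      ∣A⁺∣<u = subst (_< bound) (sym eqA) (≤-<-trans (m⊓n≤n n _) (≤-reflexive (suc-pred bound {{>-nonZero (proj₂ u)}})))

    irreducible-stuck : ∀ {A B} → bound ≤ ∣ A ∣ → ¬ Removable A → Star Move A B → A ≡ B
    irreducible-stuck u≤∣A∣ fixed ε = refl
    irreducible-stuck {A} u≤∣A∣ fixed (_◅_ {j = C} (_ , s , (coverC , ∣C∣≤u)) _) with Flip-cases A C s
    ... | x , inj₁ (x∉A , refl) = contradiction (≤-trans ∣C∣≤u u≤∣A∣) (<⇒≱ (≤-reflexive (sym (∣insert∣ A x x∉A))))
    ... | x , inj₂ (x∈A , refl) = contradiction (x , x∈A , coverC) fixed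

    -- A tight cover inside the current set can never be given up: removing one of its tokens x
    -- would leave another tight cover, which contains x + k but not x.
    tight-kept : ∀ {P} → k < n → k * pred bound ≤ n → Cover P → ∣ P ∣ < bound →
      ∀ {A B} → Star Move A B → P ⊆ A → P ⊆ B
    tight-kept k<n small coverP ∣P∣<u ε P⊆A = P⊆A
    tight-kept {P} k<n small coverP ∣P∣<u {A} (_◅_ {j = C} ((_ , ∣A∣≤u) , s , (coverC , _)) rest) P⊆A =
      tight-kept k<n small coverP ∣P∣<u rest (onward (Flip-cases A C s))
      where
      exact : ∀ D → Cover D → ∣ D ∣ < bound → ∀ i → lookup D (at (k + i)) ≡ lookup D (at i)
      exact D coverD ∣D∣<u = tight D hits (≤-antisym (≤-trans (*-monoʳ-≤ k (<⇒≤pred ∣D∣<u)) small) (Hits⇒size D hits))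
        where hits = cover⇒Hits D (<⇒≤ k<n) coverD
      onward : (∃ λ x → (lookup A x ≡ false × C ≡ A [ x ]≔ true) ⊎ (lookup A x ≡ true × C ≡ A [ x ]≔ false)) → P ⊆ C
      onward (x , inj₁ (_ , refl)) = insert-⊇ A x ∘ P⊆A
      onward (x , inj₂ (x∈A , refl)) = lookup-⊆ λ v v∈P → trans (lookup∘update′ (x∉P v v∈P) A false) (⊆-lookup P⊆A v∈P)
        where
        ∣C∣<u : ∣ C ∣ < bound
        ∣C∣<u = ≤-trans (≤-reflexive (∣remove∣ A x x∈A)) ∣A∣≤u
        x∉P : ∀ v → lookup P v ≡ true → v ≢ x
        x∉P v v∈P refl = contradiction (begin
          true                       ≡⟨ ⊆-lookup P⊆A next∈P ⟨
          lookup A (at (k + i))      ≡⟨ lookup∘update′ (λ eq → apart 0<k k<n (trans eq (sym (proj₂ (onto x))))) A false ⟨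
          lookup C (at (k + i))      ≡⟨ exact C coverC ∣C∣<u i ⟩
          lookup C (at i)            ≡⟨ cong (lookup C) (proj₂ (onto x)) ⟩
          lookup C x                 ≡⟨ lookup∘update x A false ⟩
          false                      ∎) λ ()
          where
          open ≡-Reasoning
          i = proj₁ (onto x)
          next∈P : lookup P (at (k + i)) ≡ true
          next∈P = trans (exact P coverP ∣P∣<u i) (trans (cong (lookup P) (proj₂ (onto x))) v∈P)

    -- A cover below the bound inside `A` is tight here, is never given up, and so lies in `B` as
    -- well.
    no-room⇒∩-cover : ∀ {A B} → k < n → k * pred bound ≤ n → Cover A → ∣ A ∣ ≤ bound → Reducible A →
      Star Move A B → Cover (A ∩ B)
    no-room⇒∩-cover {A} {B} k<n small coverA ∣A∣≤u redA moves
      with P , P⊆A , coverP , ∣P∣<u ← reduce coverA ∣A∣≤u redA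
      = cover-⊆ {G = G} (λ x∈P → x∈p∩q⁺ (P⊆A x∈P , tight-kept k<n small coverP ∣P∣<u moves P⊆A x∈P)) coverP

-- Weakest preconditions for the random access machine

-- Charging both branches of a test gives an upper bound. The default 1 makes no false claim about
-- loops, as their `wp` is empty.
cost : Program → ℕ
cost (P ⨾ Q)          = cost P + cost Q
cost (ifLess r s P Q) = suc (cost P + cost Q)
cost _                = 1

-- Loops get no precondition; `loop` runs them from an invariant and a known number of rounds.
wp : Program → (State → Set) → State → Set
wp skip             Q σ = Q σ
wp (const r v)      Q σ = Q (setReg σ r v)
wp (copy r s)       Q σ = Q (setReg σ r (reg σ s))
wp (inc r)          Q σ = Q (setReg σ r (suc (reg σ r)))
wp (dec r)          Q σ = Q (setReg σ r (pred (reg σ r)))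
wp (load r a s)     Q σ = Q (setReg σ r (arr σ a (reg σ s)))
wp (store a s r)    Q σ = Q (setArr σ a (reg σ s) (reg σ r))
wp (P ⨾ P′)         Q σ = wp P (wp P′ Q) σ
wp (ifLess r s P P′) Q σ = (reg σ r < reg σ s → wp P Q σ) × (reg σ s ≤ reg σ r → wp P′ Q σ)
wp (whileLess _ _ _) Q σ = ⊥

wp-mono : ∀ P {Q Q′ : State → Set} {σ} → (∀ τ → Q τ → Q′ τ) → wp P Q σ → wp P Q′ σ
wp-mono skip           Q⇒Q′ w = Q⇒Q′ _ w
wp-mono (const r v)    Q⇒Q′ w = Q⇒Q′ _ w
wp-mono (copy r s)     Q⇒Q′ w = Q⇒Q′ _ w
wp-mono (inc r)        Q⇒Q′ w = Q⇒Q′ _ w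
wp-mono (dec r)        Q⇒Q′ w = Q⇒Q′ _ w
wp-mono (load r a s)   Q⇒Q′ w = Q⇒Q′ _ w
wp-mono (store a s r)  Q⇒Q′ w = Q⇒Q′ _ w
wp-mono (P ⨾ P′)       Q⇒Q′ w = wp-mono P (λ _ → wp-mono P′ Q⇒Q′) w
wp-mono (ifLess r s P P′) Q⇒Q′ (t , f) = wp-mono P Q⇒Q′ ∘ t , wp-mono P′ Q⇒Q′ ∘ f

taken : ∀ {a b} {X Y : Set} → a < b → X → (a < b → X) × (b ≤ a → Y)
taken a<b x = (λ _ → x) , λ b≤a → contradiction b≤a (<⇒≱ a<b)

skipped : ∀ {a b} {X Y : Set} → b ≤ a → Y → (a < b → X) × (b ≤ a → Y)
skipped b≤a y = (λ a<b → contradiction b≤a (<⇒≱ a<b)) , λ _ → y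

-- `wp P Q σ` computes away, and then `P` and `Q` can no longer be inferred from it; the wrapper
-- keeps them visible.
record Triple (P : Program) (Q : State → Set) (σ : State) : Set where
  constructor ⟪_⟫
  field proof : wp P Q σ
open Triple public

Runs : Program → ℕ → State → (State → Set) → Set
Runs P T σ Q = ∃₂ λ t τ → ⟨ P , σ ⟩⇓[ t ] τ × t ≤ T × Q τ

wp⇒Runs : ∀ P {Q σ} → wp P Q σ → Runs P (cost P) σ Q
wp⇒Runs skip           w = _ , _ , skip  , ≤-refl , w
wp⇒Runs (const r v)    w = _ , _ , const , ≤-refl , w
wp⇒Runs (copy r s)     w = _ , _ , copy  , ≤-refl , w
wp⇒Runs (inc r)        w = _ , _ , inc   , ≤-refl , w
wp⇒Runs (dec r)        w = _ , _ , dec   , ≤-refl , w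
wp⇒Runs (load r a s)   w = _ , _ , load  , ≤-refl , w
wp⇒Runs (store a s r)  w = _ , _ , store , ≤-refl , w
wp⇒Runs (P ⨾ P′) w with wp⇒Runs P w
... | _ , _ , run , t≤ , w′ with wp⇒Runs P′ w′
...   | _ , _ , run′ , t′≤ , q = _ , _ , run ⨾ run′ , +-mono-≤ t≤ t′≤ , q
wp⇒Runs (ifLess r s P P′) {σ = σ} (t , f) with reg σ r <? reg σ s
... | yes r<s with _ , _ , run , t≤ , q ← wp⇒Runs P (t r<s) =
        _ , _ , if-true r<s run , s≤s (≤-trans t≤ (m≤m+n _ _)) , q
... | no  r≮s with _ , _ , run , t≤ , q ← wp⇒Runs P′ (f (≮⇒≥ r≮s)) =
        _ , _ , if-false (≮⇒≥ r≮s) run , s≤s (≤-trans t≤ (m≤n+m _ _)) , q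

Triple⇒Runs : ∀ {P Q σ} → Triple P Q σ → Runs P (cost P) σ Q
Triple⇒Runs {P} t = wp⇒Runs P (proof t)

infixr 5 _then_
_then_ : ∀ {P P′ T T′ σ} {Q R : State → Set} → Runs P T σ Q → (∀ τ → Q τ → Runs P′ T′ τ R) →
  Runs (P ⨾ P′) (T + T′) σ R
(_ , _ , run , t≤ , q) then next with _ , _ , run′ , t′≤ , r ← next _ q =
  _ , _ , run ⨾ run′ , +-mono-≤ t≤ t′≤ , r

loopTime : Program → ℕ → ℕ
loopTime P n = n * suc (cost P) + 1

loop : ∀ {r s P} (N : ℕ) (Inv : ℕ → State → Set) → (∀ {j σ} → Inv j σ → reg σ r ≡ j × reg σ s ≡ N) →
  (∀ {j σ} → j < N → Inv j σ → Triple P (Inv (suc j)) σ) →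
  ∀ {σ} → Inv 0 σ → Runs (whileLess r s P) (loopTime P N) σ (Inv N)
loop {r} {s} {P} N Inv control body = go N 0 (+-identityʳ N)
  where
  go : ∀ d j → d + j ≡ N → ∀ {σ} → Inv j σ → Runs (whileLess r s P) (loopTime P d) σ (Inv N)
  go zero j refl inv with control inv
  ... | r≡ , s≡ = _ , _ , while-false (≤-reflexive (trans s≡ (sym r≡))) , ≤-refl , inv
  go (suc d) j eq inv with control inv
  ... | r≡ , s≡ with Triple⇒Runs (body (subst (j <_) eq (s≤s (m≤n+m j d))) inv)
  ...   | _ , _ , run , t≤ , inv′ with go d (suc j) (trans (+-suc d j) eq) inv′
  ...     | _ , _ , run′ , t′≤ , done = _ , _ ,
            while-true (subst₂ _<_ (sym r≡) (sym s≡) (subst (j <_) eq (s≤s (m≤n+m j d)))) run run′ ,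
            s≤s (≤-trans (+-mono-≤ t≤ t′≤) (≤-reflexive (sym (+-assoc (cost P) _ 1)))) , done

-- Unrolled in the program text: k is fixed, so this contributes only a constant to the running
-- time.
repeat : ℕ → Program → Program
repeat zero    P = skip
repeat (suc k) P = P ⨾ repeat k P

wp-repeat : ∀ {P} (Inv : ℕ → State → Set) → (∀ {j σ} → Inv j σ → wp P (Inv (suc j)) σ) →
  ∀ k {j σ} → Inv j σ → wp (repeat k P) (Inv (k + j)) σ
wp-repeat Inv body zero    inv = inv
wp-repeat {P} Inv body (suc k) {j} {σ} inv = wp-mono P (λ τ inv′ →
  subst (λ x → wp (repeat k P) (Inv x) τ) (+-suc k j) (wp-repeat Inv body k inv′)) (body inv)

plus-0 : ∀ {a s x} → a ≡ s → x ≡ 0 → a ≡ s + x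
plus-0 refl refl = sym (+-identityʳ _)

plus-1 : ∀ {a s x} → a ≡ s → x ≡ 1 → suc a ≡ s + x
plus-1 refl refl = +-comm 1 _

one : ∀ {z x} → z ≡ 0 → x ≡ 1 → z < x
one refl refl = ≤-refl

none : ∀ {z x} → x ≡ 0 → x ≤ z
none refl = z≤n

-- Register 2 holds 0 throughout, register 3 the constant k, registers 4 and 5 the sizes of the two
-- covers, register 6 the loop counter, registers 14 and 15 are scratch; register 20 receives k times
-- the content of register 21, capped at n.

countBody : Program
countBody = load 14 2 6 ⨾ load 15 3 6 ⨾ ifLess 2 14 (inc 4) skip ⨾ ifLess 2 15 (inc 5) skip ⨾ inc 6

countTokens : Program
countTokens = (const 2 0 ⨾ const 4 0 ⨾ const 5 0 ⨾ const 6 0) ⨾ whileLess 6 0 countBody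

countTime : ℕ → ℕ
countTime n = 4 + loopTime countBody n

scaleBody : ℕ → Program
scaleBody k = ifLess 6 21 (repeat k (inc 20)) skip ⨾ inc 6

-- Taking the minimum with n keeps the time linear: register 21 holds u − 1, which is unbounded.
scale : ℕ → Program
scale k = (const 20 0 ⨾ const 6 0) ⨾ whileLess 6 0 (scaleBody k)

scaleTime : ℕ → ℕ → ℕ
scaleTime k n = 2 + loopTime (scaleBody k) n

record Counts (σ₀ : State) (n a b : ℕ) (σ : State) : Set where
  field
    order  : reg σ 0 ≡ n
    bound  : reg σ 1 ≡ reg σ₀ 1
    zeroed : reg σ 2 ≡ 0
    source : reg σ 4 ≡ a
    goal   : reg σ 5 ≡ b
    arrays : arr σ ≡ arr σ₀

count-correct : ∀ {n} {I J : Subset n} {σ} → reg σ 0 ≡ n → Represents (arr σ 2) I → Represents (arr σ 3) J →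
  Runs countTokens (countTime n) σ (Counts σ n (∣ I ∣) (∣ J ∣))
count-correct {n} {I} {J} {σ₀} n≡ reprI reprJ =
  Triple⇒Runs {Q = Inv 0} ⟪ record
    { counts = record { order = n≡ ; bound = refl ; zeroed = refl ; source = refl ; goal = refl ; arrays = refl }
    ; index = refl } ⟫ then λ τ inv → done (loop n Inv (λ inv → Inv.index inv , Counts.order (Inv.counts inv)) (λ j<n inv → ⟪ body j<n inv ⟫) inv)
  where
  f = arr σ₀ 2
  g = arr σ₀ 3
  record Inv (j : ℕ) (σ : State) : Set where
    field
      counts : Counts σ₀ n (sumTo f j) (sumTo g j) σ
      index  : reg σ 6 ≡ j
  bit-at : ∀ {h} {A : Subset n} → Represents h A → ∀ {j} → j < n → h j ≡ 0 ⊎ h j ≡ 1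
  bit-at {h} {A} repr {j} j<n = subst (λ x → x ≡ 0 ⊎ x ≡ 1)
    (trans (sym (repr (fromℕ< j<n))) (cong h (toℕ-fromℕ< j<n))) (bits (lookup A (fromℕ< j<n)))
  total : ∀ {h} {A : Subset n} → Represents h A → sumTo h n ≡ ∣ A ∣
  total {h} {A} repr = trans (sumTo≡sum {n} h (bit ∘ lookup A) repr) (sum-bits A)
  done : ∀ {T τ} → Runs (whileLess 6 0 countBody) T τ (Inv n) → Runs (whileLess 6 0 countBody) T τ (Counts σ₀ n (∣ I ∣) (∣ J ∣))
  done (t , τ , run , t≤ , inv) = t , τ , run , t≤ ,
    subst₂ (λ a b → Counts σ₀ n a b τ) (total {f} {I} reprI) (total {g} {J} reprJ) (Inv.counts inv)
  body : ∀ {j σ} → j < n → Inv j σ → wp countBody (Inv (suc j)) σ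
  body j<n inv = at-index (Inv.index inv) (Counts.arrays (Inv.counts inv)) j<n inv
    where
    -- With registers and arrays as variables, matching on `refl` identifies the index with `j` and
    -- the arrays with the initial ones.
    at-index : ∀ {j ρ α} → ρ 6 ≡ j → α ≡ arr σ₀ → j < n → Inv j (state ρ α) → wp countBody (Inv (suc j)) (state ρ α)
    at-index {j} {ρ} refl refl j<n inv = go (bit-at {f} {I} reprI j<n) (bit-at {g} {J} reprJ j<n)
      where
      open Counts (Inv.counts inv)
      next : ∀ {ρ′} → ρ′ 0 ≡ ρ 0 → ρ′ 1 ≡ ρ 1 → ρ′ 2 ≡ ρ 2 → ρ′ 6 ≡ suc j →
        ρ′ 4 ≡ sumTo f (suc j) → ρ′ 5 ≡ sumTo g (suc j) → Inv (suc j) (state ρ′ (arr σ₀))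
      next e₀ e₁ e₂ e₆ e₄ e₅ = record
        { counts = record { order = trans e₀ order ; bound = trans e₁ bound ; zeroed = trans e₂ zeroed
                          ; source = e₄ ; goal = e₅ ; arrays = refl }
        ; index = e₆ }
      go : f j ≡ 0 ⊎ f j ≡ 1 → g j ≡ 0 ⊎ g j ≡ 1 → wp countBody (Inv (suc j)) (state ρ (arr σ₀))
      go (inj₁ x) (inj₁ y) = skipped (none x) (skipped (none y) (next refl refl refl refl (plus-0 source x) (plus-0 goal y)))
      go (inj₁ x) (inj₂ y) = skipped (none x) (taken (one zeroed y) (next refl refl refl refl (plus-0 source x) (plus-1 goal y)))
      go (inj₂ x) (inj₁ y) = taken (one zeroed x) (skipped (none y) (next refl refl refl refl (plus-1 source x) (plus-0 goal y)))
      go (inj₂ x) (inj₂ y) = taken (one zeroed x) (taken (one zeroed y) (next refl refl refl refl (plus-1 source x) (plus-1 goal y)))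

record Scaled (k : ℕ) (σ₀ : State) (n a b c : ℕ) (σ : State) : Set where
  field
    counts  : Counts σ₀ n a b σ
    product : reg σ 20 ≡ k * (n ⊓ c)

scale-correct : ∀ k {σ₀ n a b c σ} → Counts σ₀ n a b σ → reg σ 21 ≡ c →
  Runs (scale k) (scaleTime k n) σ (Scaled k σ₀ n a b c)
scale-correct k {σ₀} {n} {a} {b} {c} {σ} start cap =
  Triple⇒Runs {Q = Inv 0} ⟪ record
    -- The fields are re-packed at a new state, which differs only in registers 20 and 6; no field
    -- of `Counts` reads these.
    { counts = record { Counts start } ; factor = cap ; index = refl ; partial = sym (*-zeroʳ k) } ⟫
  then λ τ inv → done (loop n Inv (λ inv → Inv.index inv , Counts.order (Inv.counts inv)) (λ _ inv → ⟪ body inv ⟫) inv)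
  where
  record Inv (j : ℕ) (σ : State) : Set where
    field
      counts  : Counts σ₀ n a b σ
      factor  : reg σ 21 ≡ c
      index   : reg σ 6 ≡ j
      partial : reg σ 20 ≡ k * (j ⊓ c)
  done : ∀ {T τ} → Runs (whileLess 6 0 (scaleBody k)) T τ (Inv n) →
    Runs (whileLess 6 0 (scaleBody k)) T τ (Scaled k σ₀ n a b c)
  done (t , τ , run , t≤ , inv) = t , τ , run , t≤ , record { counts = Inv.counts inv ; product = Inv.partial inv }
  record Added (j t : ℕ) (σ : State) : Set where
    field
      counts  : Counts σ₀ n a b σ
      factor  : reg σ 21 ≡ c
      index   : reg σ 6 ≡ j
      partial : reg σ 20 ≡ t + k * (j ⊓ c)
  body : ∀ {j σ} → Inv j σ → wp (scaleBody k) (Inv (suc j)) σ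
  body {j} {σ} inv with j <? c
  ... | no j≮c = skipped (≤-trans (≤-reflexive factor) (≤-trans (≮⇒≥ j≮c) (≤-reflexive (sym index))))
        record { counts = record { Counts counts } ; factor = factor ; index = cong suc index
               ; partial = trans partial (cong (k *_) (trans (m≥n⇒m⊓n≡n (≮⇒≥ j≮c)) (sym (m≥n⇒m⊓n≡n (m≤n⇒m≤1+n (≮⇒≥ j≮c)))))) }
    where open Inv inv
  ... | yes j<c = taken (subst₂ _<_ (sym index) (sym factor) j<c)
        (wp-mono (repeat k (inc 20)) (λ τ add → record
          { counts = record { Counts (Added.counts add) } ; factor = Added.factor add ; index = cong suc (Added.index add)
          ; partial = trans (Added.partial add) (trans (cong (λ x → x + k * (j ⊓ c)) (+-identityʳ k))
              (trans (sym (*-suc k (j ⊓ c))) (cong (k *_) (trans (cong suc (m≤n⇒m⊓n≡m (<⇒≤ j<c))) (sym (m≤n⇒m⊓n≡m j<c)))))) })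
          (wp-repeat (Added j) (λ add → record { counts = record { Counts (Added.counts add) } ; factor = Added.factor add ; index = Added.index add
             ; partial = cong suc (Added.partial add) }) k
            (record { counts = counts ; factor = factor ; index = index ; partial = partial })))
    where
    open Inv inv

-- Examining the windows of a cycle

module WalkingMachine {n} {G : Graph n} {offset target : ℕ → ℕ} (lists : AdjacencyLists G offset target) where
  open Graph G using (Adj)
  open AdjacencyLists lists

  first-in-list : ∀ {v w} → Adj v w → InList v (offset (toℕ v))
  first-in-list {v} {w} adj with e , (from , to) , _ ← complete v w adj = ≤-refl , ≤-<-trans from to

  first-neighbour : ∀ {v w} → Adj v w → ∃ λ w′ → target (offset (toℕ v)) ≡ toℕ w′ × Adj v w′
  first-neighbour {v} adj = sound v _ (first-in-list adj)

  module _ (W : Walk G) where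
    open WalkProperties W

    two-apart : ∀ i → at (2 + i) ≢ at i
    two-apart i = apart (s≤s z≤n) large

    back : ∀ i → Adj (at (suc i)) (at i)
    back i = Graph.sym G (adjacent i)

    next-first : ∀ i → target (offset (toℕ (at (suc i)))) ≢ toℕ (at i) →
      target (offset (toℕ (at (suc i)))) ≡ toℕ (at (2 + i))
    next-first i ne with w , e≡ , adj ← first-neighbour (back i) with neighbours i adj
    ... | inj₁ w≡ = contradiction (trans e≡ (cong toℕ w≡)) ne
    ... | inj₂ w≡ = trans e≡ (cong toℕ w≡)

    -- The list has a second entry because the forward neighbour differs from the first entry, and
    -- `unique` keeps that second entry from being the vertex just left.
    next-second : ∀ i → target (offset (toℕ (at (suc i)))) ≡ toℕ (at i) →
      target (suc (offset (toℕ (at (suc i))))) ≡ toℕ (at (2 + i))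
    next-second i eq
      with e , (from , to) , e≡ ← complete _ _ (adjacent (suc i))
      with m≤n⇒m<n∨m≡n from
    ... | inj₂ refl = contradiction (toℕ-injective (trans (sym e≡) eq)) (two-apart i)
    ... | inj₁ later with w , s≡ , adj ← sound (at (suc i)) _ (n≤1+n _ , ≤-<-trans later to) with neighbours i adj
    ...   | inj₂ w≡ = trans s≡ (cong toℕ w≡)
    ...   | inj₁ w≡ = contradiction (unique _ _ _ (≤-refl , ≤-<-trans from to) (n≤1+n _ , ≤-<-trans later to)
              (trans eq (sym (trans s≡ (cong toℕ w≡))))) (<⇒≢ ≤-refl)

-- Registers 9 and 10 hold two consecutive vertices of the walk, 11, 12 and 13 count the tokens
-- of I, of J and of both that were met.

tally advance : Program
tally = load 14 2 9 ⨾ load 15 3 9 ⨾ ifLess 2 14 (inc 11 ⨾ ifLess 2 15 (inc 13) skip) skip ⨾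
  ifLess 2 15 (inc 12) skip
advance = load 14 0 10 ⨾ load 15 1 14 ⨾
  ifLess 15 9 skip (ifLess 9 15 skip (inc 14 ⨾ load 15 1 14)) ⨾ copy 9 10 ⨾ copy 10 15

walkOn : Program
walkOn = tally ⨾ advance

-- Registers 7 and 8 hold the first two vertices of the window under examination. Register 17 is
-- set when some window of length k misses I ∩ J, registers 18 and 19 when some window of length
-- k + 1 holds three tokens of I or of J.
scanBody : ℕ → Program
scanBody k =
  (copy 9 7 ⨾ copy 10 8 ⨾ const 11 0 ⨾ const 12 0 ⨾ const 13 0) ⨾ walkOn ⨾ (copy 7 9 ⨾ copy 8 10) ⨾
  repeat (pred k) walkOn ⨾ ifLess 2 13 skip (const 17 1) ⨾ walkOn ⨾
  (const 14 2 ⨾ ifLess 14 11 (const 18 1) skip) ⨾ ifLess 14 12 (const 19 1) skip ⨾ inc 6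

-- The registers that walkOn leaves alone.
record Frame : Set where
  field r0 r1 r4 r5 r6 r7 r8 r17 r18 r19 r20 : ℕ
open Frame

frame : (ℕ → ℕ) → Frame
frame ρ = record { r0 = ρ 0 ; r1 = ρ 1 ; r4 = ρ 4 ; r5 = ρ 5 ; r6 = ρ 6 ; r7 = ρ 7 ; r8 = ρ 8
                 ; r17 = ρ 17 ; r18 = ρ 18 ; r19 = ρ 19 ; r20 = ρ 20 }

Found : (ℕ → Set) → ℕ → ℕ → Set
Found P r m = (r ≡ 1 × ∃ P) ⊎ (r ≡ 0 × ∀ i → i < m → ¬ P i)

found-skip : ∀ {P r m} → ¬ P m → Found P r m → Found P r (suc m)
found-skip ¬Pm (inj₁ found) = inj₁ found
found-skip ¬Pm (inj₂ (r≡0 , none)) = inj₂ (r≡0 , λ i i<1+m →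
  [ none i , (λ { refl → ¬Pm }) ]′ (m≤n⇒m<n∨m≡n (≤-pred i<1+m)))

module Scan {n} {G : Graph n} (W : Walk G) (I J : Subset n) {k : ℕ} (0<k : 0 < k) (α : ℕ → ℕ → ℕ)
  (lists : AdjacencyLists G (α 0) (α 1)) (reprI : Represents (α 2) I) (reprJ : Represents (α 3) J)
  (U A B M : ℕ) where
  open Windows W
  open WalkingMachine lists

  At : ((ℕ → ℕ) → Set) → State → Set
  At X σ = arr σ ≡ α × X (reg σ)

  -- Cutting at an explicit condition `X`, with the arrays fixed at `α`, lets `wp` continue from a
  -- fresh `ρ` instead of a growing term.
  chain : ∀ {P P′ Q} X {σ} → Triple P (At X) σ → (∀ ρ → X ρ → Triple P′ Q (state ρ α)) → Triple (P ⨾ P′) Q σ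
  chain {P} X w next = ⟪ wp-mono P (λ { (state ρ _) (refl , x) → proof (next ρ x) }) (proof w) ⟫

  -- In the window starting at index `i`, `c` vertices have been tallied and `j` steps taken; the
  -- two numbers differ between `tally` and `advance`.
  record Inner (F : Frame → Set) (i c j : ℕ) (ρ : ℕ → ℕ) : Set where
    field
      kept     : F (frame ρ)
      zeroed   : ρ 2 ≡ 0
      previous : ρ 9 ≡ toℕ (at (j + i))
      current  : ρ 10 ≡ toℕ (at (suc j + i))
      source   : ρ 11 ≡ window c I i
      goal     : ρ 12 ≡ window c J i
      both     : ρ 13 ≡ window c (I ∩ J) i

  lookup-∩ : ∀ v {a b} → lookup I v ≡ a → lookup J v ≡ b → lookup (I ∩ J) v ≡ a ∧ b
  lookup-∩ v eq eq′ = trans (lookup-zipWith _∧_ v I J) (cong₂ _∧_ eq eq′)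

  tally-correct : ∀ {F i j ρ} → Inner F i j j ρ → wp tally (At (Inner F i (suc j) j)) (state ρ α)
  tally-correct {F} {i} {j} {ρ} inner = go _ _ refl refl (read {α 2} {I} reprI refl) (read {α 3} {J} reprJ refl)
    where
    open Inner inner
    read : ∀ {f} {C : Subset n} {x} → Represents f C → lookup C (at (j + i)) ≡ x → f (ρ 9) ≡ bit x
    read {f} repr eq = trans (cong f previous) (trans (repr _) (cong bit eq))
    go : ∀ a b → lookup I (at (j + i)) ≡ a → lookup J (at (j + i)) ≡ b → α 2 (ρ 9) ≡ bit a → α 3 (ρ 9) ≡ bit b →
      wp tally (At (Inner F i (suc j) j)) (state ρ α)
    go true true eqI eqJ x y = taken (one zeroed x) (taken (one zeroed y) (taken (one zeroed y) (refl , record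
      { kept = kept ; zeroed = zeroed ; previous = previous ; current = current
      ; source = plus-1 source (cong bit eqI) ; goal = plus-1 goal (cong bit eqJ) ; both = plus-1 both (cong bit (lookup-∩ _ eqI eqJ)) })))
    go true false eqI eqJ x y = taken (one zeroed x) (skipped (none y) (skipped (none y) (refl , record
      { kept = kept ; zeroed = zeroed ; previous = previous ; current = current
      ; source = plus-1 source (cong bit eqI) ; goal = plus-0 goal (cong bit eqJ) ; both = plus-0 both (cong bit (lookup-∩ _ eqI eqJ)) })))
    go false true eqI eqJ x y = skipped (none x) (taken (one zeroed y) (refl , record
      { kept = kept ; zeroed = zeroed ; previous = previous ; current = current
      ; source = plus-0 source (cong bit eqI) ; goal = plus-1 goal (cong bit eqJ) ; both = plus-0 both (cong bit (lookup-∩ _ eqI eqJ)) }))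
    go false false eqI eqJ x y = skipped (none x) (skipped (none y) (refl , record
      { kept = kept ; zeroed = zeroed ; previous = previous ; current = current
      ; source = plus-0 source (cong bit eqI) ; goal = plus-0 goal (cong bit eqJ) ; both = plus-0 both (cong bit (lookup-∩ _ eqI eqJ)) }))

  advance-correct : ∀ {F i c j ρ} → Inner F i c j ρ → wp advance (At (Inner F i c (suc j))) (state ρ α)
  advance-correct {F} {i} {c} {j} {ρ} inner =
    (λ lt → refl , record
        { kept = kept ; zeroed = zeroed ; previous = current ; current = to-first (<⇒≢ lt)
        ; source = source ; goal = goal ; both = both }) ,
    (λ le → (λ lt → refl , record
        { kept = kept ; zeroed = zeroed ; previous = current ; current = to-first (>⇒≢ lt)
        ; source = source ; goal = goal ; both = both }) ,
      (λ ge → refl , record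
        { kept = kept ; zeroed = zeroed ; previous = current ; current = to-second (≤-antisym ge le)
        ; source = source ; goal = goal ; both = both }))
    where
    open Inner inner
    to-first : α 1 (α 0 (ρ 10)) ≢ ρ 9 → α 1 (α 0 (ρ 10)) ≡ toℕ (at (2 + j + i))
    to-first ne = trans (cong (α 1 ∘ α 0) current) (next-first W (j + i)
      (λ eq → ne (trans (cong (α 1 ∘ α 0) current) (trans eq (sym previous)))))
    to-second : α 1 (α 0 (ρ 10)) ≡ ρ 9 → α 1 (suc (α 0 (ρ 10))) ≡ toℕ (at (2 + j + i))
    to-second eq = trans (cong (α 1 ∘ suc ∘ α 0) current) (next-second W (j + i)
      (trans (sym (cong (α 1 ∘ α 0) current)) (trans eq previous)))

  walkOn-correct : ∀ {F i j ρ} → Inner F i j j ρ → Triple walkOn (At (Inner F i (suc j) (suc j))) (state ρ α)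
  walkOn-correct {F} {i} {j} inner = chain (Inner F i (suc j) j) ⟪ tally-correct inner ⟫ λ _ inner → ⟪ advance-correct inner ⟫

  walkOn-repeated : ∀ {F i j ρ} m → Inner F i j j ρ →
    Triple (repeat m walkOn) (At (Inner F i (m + j) (m + j))) (state ρ α)
  walkOn-repeated {F} {i} m inner = ⟪ wp-repeat (λ j → At (Inner F i j j))
    (λ { {σ = state ρ _} (refl , inner) → proof (walkOn-correct inner) }) m (refl , inner) ⟫

  CoverlessBoth CrowdedI CrowdedJ : ℕ → Set
  CoverlessBoth i = window k (I ∩ J) i ≡ 0
  CrowdedI i = 2 < window (suc k) I i
  CrowdedJ i = 2 < window (suc k) J i

  -- x, c: walk position and loop counter; i₁, i₂, i₃: windows examined so far by each test.
  record Facts (x c i₁ i₂ i₃ : ℕ) (f : Frame) : Set where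
    field
      order    : r0 f ≡ n
      bound    : r1 f ≡ U
      sizeI    : r4 f ≡ A
      sizeJ    : r5 f ≡ B
      product  : r20 f ≡ M
      counter  : r6 f ≡ c
      from     : r7 f ≡ toℕ (at x)
      to       : r8 f ≡ toℕ (at (suc x))
      foundB   : Found CoverlessBoth (r17 f) i₁
      foundI   : Found CrowdedI (r18 f) i₂
      foundJ   : Found CrowdedJ (r19 f) i₃

  Scanned : ℕ → (ℕ → ℕ) → Set
  Scanned i ρ = ρ 2 ≡ 0 × Facts i i i i i (frame ρ)

  scan-correct : ∀ {i ρ} → Scanned i ρ → Triple (scanBody k) (At (Scanned (suc i))) (state ρ α)
  scan-correct {i} (ρ2≡0 , facts) =
    chain (Inner (Facts i i i i i) i 0 0)
      ⟪ refl , record { kept = record { Facts facts } ; zeroed = ρ2≡0 ; previous = Facts.from facts ; current = Facts.to facts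
                     ; source = refl ; goal = refl ; both = refl } ⟫ λ ρ inner →
    chain (Inner (Facts i i i i i) i 1 1) (walkOn-correct inner) λ ρ inner →
    -- After one step registers 9 and 10 hold the start of the next window, which is saved now.
    chain (Inner (Facts (suc i) i i i i) i 1 1)
      ⟪ refl , record { Inner inner ; kept = record { Facts (Inner.kept inner) ; from = Inner.previous inner ; to = Inner.current inner } } ⟫
      λ ρ inner →
    -- One vertex was tallied before the save; `pred k` more complete the window of length k.
    chain (Inner (Facts (suc i) i i i i) i k k)
      (subst (λ j → Triple (repeat (pred k) walkOn) (At (Inner (Facts (suc i) i i i i) i j j)) (state ρ α))
        (trans (+-comm (pred k) 1) (suc-pred k {{>-nonZero 0<k}})) (walkOn-repeated (pred k) inner)) λ ρ inner →
    chain (Inner (Facts (suc i) i (suc i) i i) i k k) ⟪ checkB inner ⟫ λ ρ inner →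
    chain (Inner (Facts (suc i) i (suc i) i i) i (suc k) (suc k)) (walkOn-correct inner) λ ρ inner →
    chain (λ ρ → ρ 14 ≡ 2 × Inner (Facts (suc i) i (suc i) (suc i) i) i (suc k) (suc k) ρ) ⟪ checkI inner ⟫ λ ρ inner →
    chain (Inner (Facts (suc i) i (suc i) (suc i) (suc i)) i (suc k) (suc k))
      ⟪ checkJ inner ⟫ λ ρ inner →
    ⟪ refl , Inner.zeroed inner , record { Facts (Inner.kept inner) ; counter = cong suc (Facts.counter (Inner.kept inner)) } ⟫
    where
    checkB : ∀ {ρ x j} → Inner (Facts x i i i i) i k j ρ →
      wp (ifLess 2 13 skip (const 17 1)) (At (Inner (Facts x i (suc i) i i) i k j)) (state ρ α)
    checkB inner =
      (λ lt → refl , record { Inner inner ; kept = record { Facts kept ; foundB =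
        found-skip (λ none → contradiction (trans both none) (>⇒≢ (≤-<-trans z≤n lt))) (Facts.foundB kept) } }) ,
      (λ le → refl , record { Inner inner ; kept = record { Facts kept ; foundB =
        inj₁ (refl , i , trans (sym both) (n≤0⇒n≡0 (≤-trans le (≤-reflexive zeroed)))) } })
      where open Inner inner
    checkI : ∀ {ρ x i₁ j} → Inner (Facts x i i₁ i i) i (suc k) j ρ →
      wp (const 14 2 ⨾ ifLess 14 11 (const 18 1) skip)
        (At (λ ρ → ρ 14 ≡ 2 × Inner (Facts x i i₁ (suc i) i) i (suc k) j ρ)) (state ρ α)
    checkI inner =
      (λ lt → refl , refl , record { Inner inner ; kept = record { Facts kept ; foundI =
        inj₁ (refl , i , subst (2 <_) source lt) } }) ,
      (λ le → refl , refl , record { Inner inner ; kept = record { Facts kept ; foundI =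
        found-skip (λ crowded → contradiction le (<⇒≱ (subst (2 <_) (sym source) crowded))) (Facts.foundI kept) } })
      where open Inner inner
    checkJ : ∀ {ρ x i₁ i₂ j} → ρ 14 ≡ 2 × Inner (Facts x i i₁ i₂ i) i (suc k) j ρ →
      wp (ifLess 14 12 (const 19 1) skip) (At (Inner (Facts x i i₁ i₂ (suc i)) i (suc k) j)) (state ρ α)
    checkJ (two , inner) =
      (λ lt → refl , record { Inner inner ; kept = record { Facts kept ; foundJ =
        inj₁ (refl , i , subst₂ _<_ two goal lt) } }) ,
      (λ le → refl , record { Inner inner ; kept = record { Facts kept ; foundJ =
        found-skip (λ crowded → contradiction le (<⇒≱ (subst₂ _<_ (sym two) (sym goal) crowded))) (Facts.foundJ kept) } })
      where open Inner inner

-- The decision programs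

answerYes answerNo : Program
answerYes = const 0 1
answerNo  = const 0 0

decideSliding : ℕ → Program
decideSliding k = const 3 k ⨾ ifLess 4 5 answerNo (ifLess 5 4 answerNo (ifLess 0 20 answerYes (ifLess 3 0 answerNo answerYes)))

slidingProgram : ℕ → Program
slidingProgram k = countTokens ⨾ copy 21 4 ⨾ scale k ⨾ decideSliding k

slidingTime : ℕ → ℕ → ℕ
slidingTime k n = countTime n + (1 + (scaleTime k n + cost (decideSliding k)))

-- `A` is left open because TS and TJ share the program; reachability enters only through the three
-- implications.
sliding-correct : ∀ k {n} {I J : Subset n} {σ} {A : Set} →
  reg σ 0 ≡ n → Represents (arr σ 2) I → Represents (arr σ 3) J →
  (A → ∣ I ∣ ≡ ∣ J ∣) → (k < n → k * ∣ I ∣ ≤ n → ¬ A) → (∣ I ∣ ≡ ∣ J ∣ → n < k * ∣ I ∣ ⊎ n ≤ k → A) →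
  Runs (slidingProgram k) (slidingTime k n) σ (Answer A)
sliding-correct k {n} {I} {J} {σ} {A} n≡ reprI reprJ sizes blocked free =
  count-correct {I = I} {J} n≡ reprI reprJ then λ τ counts →
  Triple⇒Runs {Q = λ τ → Counts σ n (∣ I ∣) (∣ J ∣) τ × reg τ 21 ≡ ∣ I ∣}
    ⟪ record { Counts counts } , Counts.source counts ⟫ then λ τ (counts , cap) →
  scale-correct k counts cap then λ τ → decide
  where
  decide : ∀ {τ} → Scaled k σ n (∣ I ∣) (∣ J ∣) (∣ I ∣) τ → Runs (decideSliding k) (cost (decideSliding k)) τ (Answer A)
  decide {τ} scaled = Triple⇒Runs
    ⟪ ((λ lt → inj₂ (refl , λ a → <⇒≢ (subst₂ _<_ source goal lt) (sizes a)))
    , λ ge → (λ lt → inj₂ (refl , λ a → <⇒≢ (subst₂ _<_ goal source lt) (sym (sizes a))))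
    , λ le → let same = ≤-antisym (subst₂ _≤_ source goal le) (subst₂ _≤_ goal source ge) in
      (λ lt → inj₁ (refl , free same (inj₁ (subst₂ _<_ order multiple lt))))
    , λ small → (λ lt → inj₂ (refl , blocked (subst (k <_) order lt) (subst₂ _≤_ multiple order small)))
    , λ n≤k → inj₁ (refl , free same (inj₂ (subst (_≤ k) order n≤k)))) ⟫
    where
    open Scaled scaled
    open Counts counts
    multiple : reg τ 20 ≡ k * ∣ I ∣
    multiple = trans product (cong (k *_) (m≥n⇒m⊓n≡n (∣p∣≤n I)))

-- The machine form of `Reducible`: `P` is entered if the size is below u or the flag reports a
-- removable token.
stepwise : ℕ → ℕ → Program → Program
stepwise size flag P = ifLess size 1 P (ifLess 2 flag P answerNo)

-- The case n < k is settled before the flags are read: translating them into statements on covers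
-- and removable tokens relies on k ≤ n.
decideRoom decideAddition : Program
decideRoom = ifLess 3 0 (ifLess 0 20 answerYes answerNo) answerYes
decideAddition = ifLess 1 4 answerNo (ifLess 1 5 answerNo (ifLess 0 3 answerYes (ifLess 2 17
  (stepwise 4 18 (stepwise 5 19 decideRoom)) answerYes)))

startWalk : Program
startWalk = const 7 0 ⨾ load 14 0 7 ⨾ load 8 1 14 ⨾ const 17 0 ⨾ const 18 0 ⨾ const 19 0 ⨾ const 6 0

additionProgram : ℕ → Program
additionProgram k = countTokens ⨾ (copy 21 1 ⨾ dec 21) ⨾ scale k ⨾ startWalk ⨾
  whileLess 6 0 (scanBody k) ⨾ const 3 k ⨾ decideAddition

additionTime : ℕ → ℕ → ℕ
additionTime k n = countTime n + (2 + (scaleTime k n + (cost startWalk + (loopTime (scanBody k) n +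
  cost (const 3 k ⨾ decideAddition)))))

module AdditionCorrect {k} (2≤k : 2 ≤ k) {n} {G : Graph n} (W : Walk G) {I J : Subset n}
  (coverI : IsPathVertexCover k G I) (coverJ : IsPathVertexCover k G J) (I≢J : I ≢ J) (u : Parameter TAR)
  {α : ℕ → ℕ → ℕ} (lists : AdjacencyLists G (α 0) (α 1))
  (reprI : Represents (α 2) I) (reprJ : Represents (α 3) J) where
  open Covers W 2≤k
  open Addition u
  open Scan W I J (≤-trans (s≤s z≤n) 2≤k) α lists reprI reprJ bound (∣ I ∣) (∣ J ∣) (k * (n ⊓ pred bound))

  Reachable : Set
  Reachable = ReconfigurationSequence k TAR u G I J

  window-turn : ∀ m C i → window m C (n + i) ≡ window m C i
  window-turn m C i = sumTo-cong m λ t _ → trans (cong (token C) (swap-+ t n i)) (token-periodic C (t + i))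

  never-crowded : ∀ C → (∀ i → i < n → ¬ Crowded C i) → k ≤ n → ¬ Removable C
  never-crowded C none k≤n removable = nowhere (proj₁ found) (proj₂ found)
    where
    found : ∃ (Crowded C)
    found = removable⇒crowded C k≤n removable
    nowhere : ∀ i → ¬ Crowded C i
    nowhere = everywhere (λ i → ¬ Crowded C i) (λ {i} none c → none (subst (2 <_) (window-turn (suc k) C i) c)) none

  always-hit : (∀ i → i < n → ¬ CoverlessBoth i) → Hits k (I ∩ J)
  always-hit none i = window⇒hit k (I ∩ J) i (n≢0⇒n>0
    (everywhere (λ i → ¬ CoverlessBoth i) (λ {i} ¬e e → ¬e (trans (sym (window-turn k (I ∩ J) i)) e)) none i))

  decide-correct : ∀ {ρ} → Scanned n ρ → Triple (const 3 k ⨾ decideAddition) (Answer Reachable) (state ρ α)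
  decide-correct {ρ} (zeroed , facts) = ⟪ (
    (λ lt → inj₂ (refl , λ seq → <⇒≱ (subst₂ _<_ r1≡ sizeI lt) (proj₂ (valid-start seq)))) , λ leI →
    (λ lt → inj₂ (refl , λ seq → <⇒≱ (subst₂ _<_ r1≡ sizeJ lt) (proj₂ (valid-end seq)))) , λ leJ →
    let ∣I∣≤u = subst₂ _≤_ sizeI r1≡ leI
        ∣J∣≤u = subst₂ _≤_ sizeJ r1≡ leJ
    in
    (λ lt → accept (via-∩ (all-cover (subst (_< k) order lt) (I ∩ J)) ∣I∣≤u ∣J∣≤u) ∣I∣≤u) , λ k≤r0 →
    let k≤n = subst (k ≤_) order k≤r0 in
    (λ lt → decide-I (≤-<-trans z≤n lt) k≤n ∣I∣≤u ∣J∣≤u) ,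
    (λ le → accept (via-∩ (Hits⇒cover (I ∩ J) 2≤k (both-hit foundB le)) ∣I∣≤u ∣J∣≤u) ∣I∣≤u)) ⟫
    where
    open Facts facts renaming (bound to r1≡)
    accept : Star Move I J → ∣ I ∣ ≤ bound → (1 ≡ 1 × Reachable) ⊎ (1 ≡ 0 × ¬ Reachable)
    accept moves ∣I∣≤u = inj₁ (refl , fromStar (coverI , ∣I∣≤u) moves)
    reject : (Star Move I J → ⊥) → (0 ≡ 1 × Reachable) ⊎ (0 ≡ 0 × ¬ Reachable)
    reject stuck = inj₂ (refl , stuck ∘ toStar)
    both-hit : ∀ {r} → Found CoverlessBoth r n → r ≤ ρ 2 → Hits k (I ∩ J)
    both-hit (inj₁ (refl , _)) le = contradiction (≤-trans le (≤-reflexive zeroed)) λ ()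
    both-hit (inj₂ (_ , none)) le = always-hit none
    removable : ∀ {C r} → k ≤ n → IsPathVertexCover k G C → ρ 2 < r → Found (Crowded C) r n → Removable C
    removable {C} k≤n cover lt (inj₁ (_ , _ , crowded)) = crowded⇒removable C k≤n (cover⇒Hits C k≤n cover) crowded
    removable k≤n cover lt (inj₂ (refl , _)) = contradiction lt λ ()
    fixed : ∀ {C r} → k ≤ n → r ≤ ρ 2 → Found (Crowded C) r n → ¬ Removable C
    fixed k≤n le (inj₁ (refl , _)) = contradiction (≤-trans le (≤-reflexive zeroed)) λ ()
    fixed {C} k≤n le (inj₂ (_ , none)) = never-crowded C none k≤n
    module _ (found : 0 < ρ 17) (k≤n : k ≤ n) (∣I∣≤u : ∣ I ∣ ≤ bound) (∣J∣≤u : ∣ J ∣ ≤ bound) where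
      ∩-no-cover : Found CoverlessBoth (ρ 17) n → ¬ IsPathVertexCover k G (I ∩ J)
      ∩-no-cover (inj₁ (_ , i , empty)) cover =
        contradiction empty (>⇒≢ (hit⇒window k (I ∩ J) i (cover⇒Hits (I ∩ J) k≤n cover i)))
      ∩-no-cover (inj₂ (r≡0 , _)) = contradiction r≡0 (>⇒≢ found)
      no-room : k < n → k * (n ⊓ pred bound) ≤ n → k * pred bound ≤ n
      no-room k<n small with ≤-total n (pred bound)
      ... | inj₂ p≤n = subst (λ x → k * x ≤ n) (m≥n⇒m⊓n≡n p≤n) small
      -- A minimum equal to n would give k n ≤ n, impossible for k ≥ 2.
      ... | inj₁ n≤p = contradiction (subst (λ x → k * x ≤ n) (m≤n⇒m⊓n≡m n≤p) small)
              (<⇒≱ (<-≤-trans (m<m+n n (>-nonZero⁻¹ n))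
                (≤-trans (≤-reflexive (cong (n +_) (sym (+-identityʳ n)))) (*-monoˡ-≤ n 2≤k))))
      decide-room : Reducible I → Reducible J → wp decideRoom (Answer Reachable) (setReg (state ρ α) 3 k)
      decide-room redI redJ =
        (λ k<r0 →
          (λ lt → accept (room⇒reachable coverI coverJ ∣I∣≤u ∣J∣≤u redI redJ (inj₂ (subst₂ _<_ order product lt))) ∣I∣≤u) ,
          (λ le → let k<n = subst (k <_) order k<r0 in reject λ moves → ∩-no-cover foundB
            (no-room⇒∩-cover k<n (no-room k<n (subst₂ _≤_ product order le)) coverI ∣I∣≤u redI moves))) ,
        (λ r0≤k → accept (room⇒reachable coverI coverJ ∣I∣≤u ∣J∣≤u redI redJ (inj₁ (subst (_≤ k) order r0≤k))) ∣I∣≤u)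
      decide-J : Reducible I → wp (stepwise 5 19 decideRoom) (Answer Reachable) (setReg (state ρ α) 3 k)
      decide-J redI =
        (λ lt → decide-room redI (inj₁ (subst₂ _<_ sizeJ r1≡ lt))) ,
        (λ ge → (λ lt → decide-room redI (inj₂ (removable k≤n coverJ lt foundJ))) ,
          -- A stuck `J` sits at the end of the sequence, which is therefore reversed.
          (λ le → reject λ moves → I≢J (sym (irreducible-stuck (subst₂ _≤_ r1≡ sizeJ ge) (fixed k≤n le foundJ) (Star-sym moves)))))
      decide-I : wp (stepwise 4 18 (stepwise 5 19 decideRoom)) (Answer Reachable) (setReg (state ρ α) 3 k)
      decide-I =
        (λ lt → decide-J (inj₁ (subst₂ _<_ sizeI r1≡ lt))) ,
        (λ ge → (λ lt → decide-J (inj₂ (removable k≤n coverI lt foundI))) ,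
          (λ le → reject λ moves → I≢J (irreducible-stuck (subst₂ _≤_ r1≡ sizeI ge) (fixed k≤n le foundI) moves)))

  module _ (at₀ : toℕ (at 0) ≡ 0) (at₁ : α 1 (α 0 0) ≡ toℕ (at 1)) where

    start-correct : ∀ {σ₀ τ} → arr σ₀ ≡ α → reg σ₀ 1 ≡ bound →
      Scaled k σ₀ n (∣ I ∣) (∣ J ∣) (pred bound) τ → Triple startWalk (At (Scanned 0)) τ
    start-correct arrays₀ bound₀ scaled = ⟪ trans arrays arrays₀ , zeroed , record
      { order = order ; bound = trans bound′ bound₀ ; sizeI = source ; sizeJ = goal ; product = product ; counter = refl
      ; from = sym at₀ ; to = trans (cong (λ α → α 1 (α 0 0)) (trans arrays arrays₀)) at₁
      ; foundB = inj₂ (refl , λ _ ()) ; foundI = inj₂ (refl , λ _ ()) ; foundJ = inj₂ (refl , λ _ ()) } ⟫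
      where
      open Scaled scaled
      open Counts counts renaming (bound to bound′)

    addition-correct : ∀ {σ} → reg σ 0 ≡ n → reg σ 1 ≡ bound → arr σ ≡ α →
      Runs (additionProgram k) (additionTime k n) σ (Answer Reachable)
    addition-correct {σ} n≡ u≡ refl =
      count-correct {I = I} {J} n≡ reprI reprJ then λ τ counts →
      Triple⇒Runs {Q = λ τ → Counts σ n (∣ I ∣) (∣ J ∣) τ × reg τ 21 ≡ pred bound}
        ⟪ record { Counts counts } , cong pred (trans (Counts.bound counts) u≡) ⟫ then λ τ (counts , cap) →
      scale-correct k counts cap then λ τ scaled →
      Triple⇒Runs (start-correct refl u≡ scaled) then λ τ scanned →
      loop n (λ i → At (Scanned i))
        (λ (_ , _ , facts) → Facts.counter facts , Facts.order facts)
        (λ { {σ = state _ _} _ (refl , scanned) → scan-correct scanned }) scanned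
      then λ { (state _ _) (refl , scanned) → Triple⇒Runs (decide-correct scanned) }

-- Asymptotic bounds and the three algorithms

const-∈O : ∀ c → (λ _ → c) ∈O (λ n → n)
const-∈O c = c , 1 , λ n 1≤n → m≤m*n c n {{>-nonZero 1≤n}}

*-∈O : ∀ c → (λ n → n * c) ∈O (λ n → n)
*-∈O c = c , 0 , λ n _ → ≤-reflexive (*-comm n c)

+-∈O : ∀ {T T′ g} → T ∈O g → T′ ∈O g → (λ n → T n + T′ n) ∈O g
+-∈O {g = g} (c , N , T≤) (c′ , N′ , T′≤) = c + c′ , N + N′ , λ n N+N′≤n →
  ≤-trans (+-mono-≤ (T≤ n (≤-trans (m≤m+n N N′) N+N′≤n)) (T′≤ n (≤-trans (m≤n+m N′ N) N+N′≤n)))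
    (≤-reflexive (sym (*-distribʳ-+ (g n) c c′)))

linear⇒quadratic : ∀ {T} → T ∈O (λ n → n) → T ∈O (λ n → n * n)
linear⇒quadratic (c , N , T≤) = c , N , λ n N≤n → ≤-trans (T≤ n N≤n) (*-monoʳ-≤ c (n≤n*n n))
  where
  n≤n*n : ∀ n → n ≤ n * n
  n≤n*n zero    = z≤n
  n≤n*n (suc n) = m≤m*n (suc n) (suc n)

loopTime-∈O : ∀ P → loopTime P ∈O (λ n → n)
loopTime-∈O P = +-∈O {T = λ n → n * suc (cost P)} (*-∈O _) (const-∈O 1)

slidingTime-∈O : ∀ k → slidingTime k ∈O (λ n → n)
slidingTime-∈O k = +-∈O {countTime} (+-∈O {λ _ → 4} (const-∈O 4) (loopTime-∈O countBody))
  (+-∈O {λ _ → 1} (const-∈O 1) (+-∈O {scaleTime k} (+-∈O {λ _ → 2} (const-∈O 2) (loopTime-∈O (scaleBody k)))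
    (const-∈O (cost (decideSliding k)))))

additionTime-∈O : ∀ k → additionTime k ∈O (λ n → n)
additionTime-∈O k = +-∈O {countTime} (+-∈O {λ _ → 4} (const-∈O 4) (loopTime-∈O countBody))
  (+-∈O {λ _ → 2} (const-∈O 2) (+-∈O {scaleTime k} (+-∈O {λ _ → 2} (const-∈O 2) (loopTime-∈O (scaleBody k)))
    (+-∈O {λ _ → cost startWalk} (const-∈O _) (+-∈O {loopTime (scanBody k)} (loopTime-∈O (scanBody k)) (const-∈O _)))))

-- Obstructions are proved for jumps and connections for slides, the stronger form in each case, so
-- both rules receive the same criterion.
module SlidingSequences {k} (2≤k : 2 ≤ k) {n} {G : Graph n} (cycle : IsCycle G) {I J : Subset n}
  (coverI : IsPathVertexCover k G I) (coverJ : IsPathVertexCover k G J) (I≢J : I ≢ J) where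
  open Covers (cycleWalk {G = G} cycle) 2≤k

  blocked : k < n → k * ∣ I ∣ ≤ n → ¬ Star (CoverStep TJ) I J
  blocked k<n small moves = I≢J (tight-stuck k<n small moves)

  free : ∣ I ∣ ≡ ∣ J ∣ → n < k * ∣ I ∣ ⊎ n ≤ k → Star (CoverStep TS) I J
  free = slides coverI coverJ

  TS-to-TJ : ∀ {A B} → Star (CoverStep TS) A B → Star (CoverStep TJ) A B
  TS-to-TJ = mapStar λ { (c , (x , y , lost , gained , _) , d) → c , (x , y , lost , gained) , d }

  fromTS : ReconfigurationSequence k TS tt G I J → Star (CoverStep TJ) I J
  fromTS = TS-to-TJ ∘ mapStar (λ ((c , _) , s , (d , _)) → c , s , d) ∘ Reconfiguration.toStar k TS tt G

  fromTJ : ReconfigurationSequence k TJ tt G I J → Star (CoverStep TJ) I J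
  fromTJ = mapStar (λ ((c , _) , s , (d , _)) → c , s , d) ∘ Reconfiguration.toStar k TJ tt G

  toTS : Star (CoverStep TS) I J → ReconfigurationSequence k TS tt G I J
  toTS = Reconfiguration.fromStar k TS tt G (coverI , tt) ∘ mapStar λ (c , s , d) → (c , tt) , s , (d , tt)

  toTJ : Star (CoverStep TS) I J → ReconfigurationSequence k TJ tt G I J
  toTJ = Reconfiguration.fromStar k TJ tt G (coverI , tt) ∘ mapStar (λ (c , s , d) → (c , tt) , s , (d , tt)) ∘ TS-to-TJ

jumping-solves : ∀ k → 2 ≤ k → SolvesOnCycles k TJ (slidingProgram k) (slidingTime k)
jumping-solves k 2≤k G cycle I J coverI coverJ I≢J u σ loaded =
  sliding-correct k {I = I} {J} order source goal (∣∣-invariant ∘ fromTJ) (λ k<n small → blocked k<n small ∘ fromTJ)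
    (λ same room → toTJ (free same room))
  where
  open Loaded loaded
  open SlidingSequences 2≤k cycle coverI coverJ I≢J
  open Covers (cycleWalk {G = G} cycle) 2≤k using (∣∣-invariant)

sliding-solves : ∀ k → 2 ≤ k → SolvesOnCycles k TS (slidingProgram k) (slidingTime k)
sliding-solves k 2≤k G cycle I J coverI coverJ I≢J u σ loaded =
  sliding-correct k {I = I} {J} order source goal (∣∣-invariant ∘ fromTS) (λ k<n small → blocked k<n small ∘ fromTS)
    (λ same room → toTS (free same room))
  where
  open Loaded loaded
  open SlidingSequences 2≤k cycle coverI coverJ I≢J
  open Covers (cycleWalk {G = G} cycle) 2≤k using (∣∣-invariant)

addition-solves : ∀ k → 2 ≤ k → SolvesOnCycles k TAR (additionProgram k) (additionTime k)
addition-solves k 2≤k {n} G cycle I J coverI coverJ I≢J u σ loaded =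
  -- The walk is chosen to match `startWalk`: vertex 0, then its first listed neighbour.
  run (walkAlong {G = G} cycle (proj₂ (proj₂ neighbour)))
  where
  open Loaded loaded
  0<n : 0 < n
  0<n = ≤-trans (s≤s z≤n) (proj₁ cycle)
  v₀ : Fin n
  v₀ = fromℕ< 0<n
  some-edge : ∃ λ w → Graph.Adj G v₀ w
  some-edge with i , eq ← Walk.onto (cycleWalk {G = G} cycle) v₀ = next , subst (λ v → Graph.Adj G v next) eq edge
    where
    next = Walk.at (cycleWalk {G = G} cycle) (suc i)
    edge = Walk.adjacent (cycleWalk {G = G} cycle) i
  neighbour : ∃ λ w → arr σ 1 (arr σ 0 (toℕ v₀)) ≡ toℕ w × Graph.Adj G v₀ w
  neighbour = WalkingMachine.first-neighbour graph (proj₂ some-edge)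
  run : (Σ (Walk G) λ W → Walk.at W 0 ≡ v₀ × Walk.at W 1 ≡ proj₁ neighbour) →
    Runs (additionProgram k) (additionTime k n) σ (Answer (ReconfigurationSequence k TAR u G I J))
  run (W , at0≡ , at1≡) = AdditionCorrect.addition-correct 2≤k W coverI coverJ I≢J u graph source goal
    (trans (cong toℕ at0≡) (toℕ-fromℕ< 0<n))
    (trans (cong (λ x → arr σ 1 (arr σ 0 x)) (sym (toℕ-fromℕ< 0<n))) (trans (proj₁ (proj₂ neighbour)) (cong toℕ (sym at1≡))))
    order parameter refl

theorem10 : ∀ (k : ℕ) → 2 ≤ k →
    SolvableOnCyclesIn (λ n → n) k TJ ×
    SolvableOnCyclesIn (λ n → n) k TAR ×
    SolvableOnCyclesIn (λ n → n * n) k TS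
theorem10 k 2≤k =
  (slidingProgram k , slidingTime k , slidingTime-∈O k , jumping-solves k 2≤k) ,
  (additionProgram k , additionTime k , additionTime-∈O k , addition-solves k 2≤k) ,
  (slidingProgram k , slidingTime k , linear⇒quadratic (slidingTime-∈O k) , sliding-solves k 2≤k)
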